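{- For all integers $N,r\geq 0$ and every $f\in\mathrm{QSym}_N$, $$\Phi_{N+r}(h_r f)=\mathcal G_r\,\Phi_N(f).$$
   Context: Work over $\mathbb Q$. $\mathrm{QSym}_N$ is the degree-$N$ homogeneous component of the ring of quasisymmetric functions in commuting variables $z_1,z_2,\ldots$. For $N\geq1$ and $S\subseteq[N-1]=\{1,\ldots,N-1\}$ the fundamental quasisymmetric function is $$F_{N,S}=\sum_{\substack{1\leq i_1\leq\cdots\leq i_N\\ j\in S\Rightarrow i_j<i_{j+1}}} z_{i_1}\cdots z_{i_N},$$ and $F_{0,\varnothing}=1$; the $F_{N,S}$ form a basis of $\mathrm{QSym}_N$. The complete homogeneous symmetric function is $h_r=\sum_{1\leq i_1\leq\cdots\leq i_r}z_{i_1}\cdots z_{i_r}$, $h_0=1$. The linear map $\Phi_N:\mathrm{QSym}_N\to\mathbb Q[x,y]$ is defined by $\Phi_N(F_{N,S})=x^{|S|+1}y^{N-|S|}$, with $\Phi_0(1)=x$. With $D=\partial_x+\partial_y$, the operators $\mathcal G_r$ on $\mathbb Q[x,y]$ are $\mathcal G_0=\mathrm{id}$ and, for $r\geq1$, $\mathcal G_r=y^r\sum_{j=1}^{r}\binom{r-1}{j-1}\frac{x^j}{j!}D^j$. -}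

module Defs where

open import Algebra.Module.Bundles.Raw using (RawLeftModule)
open import Algebra.Module.Morphism.Structures using (module LeftModuleMorphisms)
open import Data.Bool.Base using (if_then_else_)
open import Data.Fin.Base using (toℕ)
import Data.Fin.Properties as Fin
open import Data.Fin.Subset using (Subset; inside; outside; ∣_∣)
open import Data.Integer.Base using (+_)
open import Data.List.Base as List using (List; []; _∷_; _++_; filter)
import Data.List.Properties as List
open import Data.Nat.Base as ℕ using (ℕ; zero; suc; _∸_; _⊔_; _!; z≤n; s≤s)
open import Data.Nat.Combinatorics using (_C_)
open import Data.Nat.GeneralisedArithmetic using (fold)
open import Data.Nat.ListAction using (sum)
import Data.Nat.Properties as ℕ
open import Data.Product.Base using (∃; _×_; _,_; proj₁; proj₂)
open import Data.Rational.Base as ℚ using (ℚ; 0ℚ; 1ℚ; _/_)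
import Data.Rational.Properties as ℚ
open import Data.Rational.Solver using (module +-*-Solver)
open import Data.Unit.Base using (⊤; tt)
open import Data.Vec.Base using ([]; _∷_)
open import Function.Base using (_∘_; id)
open import Function.Bundles using (mk⇔)
open import Level using (0ℓ)
open import Relation.Binary.Definitions using (tri<; tri≈; tri>)
open import Relation.Binary.PropositionalEquality
open import Relation.Nullary using (¬_; Dec; yes; no; does; contradiction)
open import Relation.Nullary.Decidable using (dec-false; does-⇔; _×-dec_)

open +-*-Solver using (solve; con; _:=_; _:+_; _:*_; _:-_; :-_)

open import Algebra.Properties.CommutativeMonoid.Sum ℚ.+-0-commutativeMonoid
  using () renaming (sum to ∑; sum-cong-≗ to ∑-cong; sum-replicate-zero to ∑-zero)

-- The exponent list e₁ ∷ … ∷ eₖ ∷ [] stands for z₁^e₁ ⋯ zₖ^eₖ, so lists that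
-- differ by trailing zeros stand for the same monomial.
Monomial : Set
Monomial = List ℕ

Series : Set
Series = Monomial → ℚ

positives : List ℕ → List ℕ
positives = filter (0 ℕ.<?_)

-- In particular, the coefficient is unaffected by trailing zeros.
IsQuasisymmetric : Series → Set
IsQuasisymmetric f = ∀ m m′ → positives m ≡ positives m′ → f m ≡ f m′

IsHomogeneous : ℕ → Series → Set
IsHomogeneous N f = ∀ m → sum m ≢ N → f m ≡ 0ℚ

record QSym (N : ℕ) : Set where
  field
    coeff          : Series
    homogeneous    : IsHomogeneous N coeff
    quasisymmetric : IsQuasisymmetric coeff

open QSym public

module _ {N : ℕ} where

  infix 4 _≈Q_

  _≈Q_ : QSym N → QSym N → Set
  f ≈Q g = ∀ m → coeff f m ≡ coeff g m

  _+Q_ : QSym N → QSym N → QSym N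
  f +Q g = record
    { coeff          = λ m → coeff f m ℚ.+ coeff g m
    ; homogeneous    = λ m ≢N → cong₂ ℚ._+_ (homogeneous f m ≢N) (homogeneous g m ≢N)
    ; quasisymmetric = λ m m′ eq →
        cong₂ ℚ._+_ (quasisymmetric f m m′ eq) (quasisymmetric g m m′ eq)
    }

  _*Q_ : ℚ → QSym N → QSym N
  c *Q f = record
    { coeff          = λ m → c ℚ.* coeff f m
    ; homogeneous    = λ m ≢N → trans (cong (c ℚ.*_) (homogeneous f m ≢N)) (ℚ.*-zeroʳ c)
    ; quasisymmetric = λ m m′ eq → cong (c ℚ.*_) (quasisymmetric f m m′ eq)
    }

  0Q : QSym N
  0Q = record
    { coeff          = λ _ → 0ℚ
    ; homogeneous    = λ _ _ → refl
    ; quasisymmetric = λ _ _ _ → refl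
    }

  -Q_ : QSym N → QSym N
  -Q f = record
    { coeff          = λ m → ℚ.- coeff f m
    ; homogeneous    = λ m ≢N → cong (ℚ.-_) (homogeneous f m ≢N)
    ; quasisymmetric = λ m m′ eq → cong (ℚ.-_) (quasisymmetric f m m′ eq)
    }

QSym-rawLeftModule : ℕ → RawLeftModule ℚ 0ℓ 0ℓ
QSym-rawLeftModule N = record
  { Carrierᴹ = QSym N
  ; _≈ᴹ_     = _≈Q_
  ; _+ᴹ_     = _+Q_
  ; _*ₗ_     = _*Q_
  ; 0ᴹ       = 0Q
  ; -ᴹ_      = -Q_
  }

-- conv f g m is the sum of f a * g b over all factorisations m = a b, the
-- exponent of each variable being distributed independently.
conv : Series → Series → Series
conv f g []      = f [] ℚ.* g []
conv f g (e ∷ m) =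
  ∑ {suc e} λ k → conv (f ∘ (toℕ k ∷_)) (g ∘ (e ∸ toℕ k ∷_)) m

conv-cong : ∀ {f f′ g g′} → f ≗ f′ → g ≗ g′ → conv f g ≗ conv f′ g′
conv-cong f≗ g≗ []      = cong₂ ℚ._*_ (f≗ []) (g≗ [])
conv-cong f≗ g≗ (e ∷ m) = ∑-cong {suc e} λ k →
  conv-cong (f≗ ∘ (toℕ k ∷_)) (g≗ ∘ (e ∸ toℕ k ∷_)) m

conv-zero : ∀ f g m →
            (∀ a b → sum a ℕ.+ sum b ≡ sum m → f a ℚ.* g b ≡ 0ℚ) →
            conv f g m ≡ 0ℚ
conv-zero f g []      fg≡0 = fg≡0 [] [] refl
conv-zero f g (e ∷ m) fg≡0 = trans
  (∑-cong {suc e} λ k →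
    conv-zero (f ∘ (toℕ k ∷_)) (g ∘ (e ∸ toℕ k ∷_)) m λ a b eq →
      fg≡0 (toℕ k ∷ a) (e ∸ toℕ k ∷ b)
        (trans (interchange (toℕ k) (sum a) (e ∸ toℕ k) (sum b))
          (cong₂ ℕ._+_ (ℕ.m+[n∸m]≡n (Fin.toℕ≤pred[n] k)) eq)))
  (∑-zero (suc e))
  where
  open import Algebra.Properties.CommutativeSemigroup ℕ.+-commutativeSemigroup
    using (interchange)

conv-homogeneous : ∀ {M N f g} → IsHomogeneous M f → IsHomogeneous N g →
                   IsHomogeneous (M ℕ.+ N) (conv f g)
conv-homogeneous {M} {N} {f} {g} hf hg m m≢ = conv-zero f g m vanish
  where
  vanish : ∀ a b → sum a ℕ.+ sum b ≡ sum m → f a ℚ.* g b ≡ 0ℚ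
  vanish a b eq with sum a ℕ.≟ M | sum b ℕ.≟ N
  ... | no a≢    | _        = trans (cong (ℚ._* g b) (hf a a≢)) (ℚ.*-zeroˡ (g b))
  ... | yes _    | no b≢    = trans (cong (f a ℚ.*_) (hg b b≢)) (ℚ.*-zeroʳ (f a))
  ... | yes refl | yes refl = contradiction (sym eq) m≢

quasisymmetric-∷ : ∀ {f} → IsQuasisymmetric f → ∀ k → IsQuasisymmetric (f ∘ (k ∷_))
quasisymmetric-∷ qf zero    m m′ eq = qf (0 ∷ m) (0 ∷ m′) eq
quasisymmetric-∷ qf (suc k) m m′ eq = qf (suc k ∷ m) (suc k ∷ m′) (cong (suc k ∷_) eq)

conv-positives : ∀ {f g} → IsQuasisymmetric f → IsQuasisymmetric g →
                 ∀ m → conv f g m ≡ conv f g (positives m)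
conv-positives qf qg []          = refl
conv-positives qf qg (zero ∷ m)  = trans (ℚ.+-identityʳ _) (trans
  (conv-cong (λ a → qf (0 ∷ a) a refl) (λ b → qg (0 ∷ b) b refl) m)
  (conv-positives qf qg m))
conv-positives qf qg (suc e ∷ m) = ∑-cong {suc (suc e)} λ k →
  conv-positives (quasisymmetric-∷ qf (toℕ k)) (quasisymmetric-∷ qg (suc e ∸ toℕ k)) m

conv-quasisymmetric : ∀ {f g} → IsQuasisymmetric f → IsQuasisymmetric g →
                      IsQuasisymmetric (conv f g)
conv-quasisymmetric {f} {g} qf qg m m′ eq = trans (conv-positives qf qg m)
  (trans (cong (conv f g) eq) (sym (conv-positives qf qg m′)))

infixl 7 _·_

_·_ : ∀ {M N} → QSym M → QSym N → QSym (M ℕ.+ N)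
f · g = record
  { coeff          = conv (coeff f) (coeff g)
  ; homogeneous    = conv-homogeneous (homogeneous f) (homogeneous g)
  ; quasisymmetric = conv-quasisymmetric (quasisymmetric f) (quasisymmetric g)
  }

-- The only weakly increasing sequence i₁ ≤ i₂ ≤ ⋯ with z_{i₁} z_{i₂} ⋯ = m;
-- the letter i stands for the variable z_{i+1}.
word : Monomial → List ℕ
word []      = []
word (e ∷ m) = List.replicate e 0 ++ List.map suc (word m)

-- The j-th side of a subset S of [n] says whether j is a member, counting from
-- j = 1.  StrictAt S (i₁ ∷ i₂ ∷ ⋯) says that j ∈ S implies i_j < i_{j+1}.
StrictAt : ∀ {n} → Subset n → List ℕ → Set
StrictAt (inside  ∷ S) (i ∷ i′ ∷ is) = i ℕ.< i′ × StrictAt S (i′ ∷ is)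
StrictAt (outside ∷ S) (i ∷ i′ ∷ is) = StrictAt S (i′ ∷ is)
StrictAt _             _             = ⊤

strictAt? : ∀ {n} (S : Subset n) is → Dec (StrictAt S is)
strictAt? []            _             = yes tt
strictAt? (inside  ∷ S) []            = yes tt
strictAt? (outside ∷ S) []            = yes tt
strictAt? (inside  ∷ S) (i ∷ [])      = yes tt
strictAt? (outside ∷ S) (i ∷ [])      = yes tt
strictAt? (inside  ∷ S) (i ∷ i′ ∷ is) = i ℕ.<? i′ ×-dec strictAt? S (i′ ∷ is)
strictAt? (outside ∷ S) (i ∷ i′ ∷ is) = strictAt? S (i′ ∷ is)

StrictlyMonotone : (ℕ → ℕ) → Set
StrictlyMonotone φ = ∀ {i j} → i ℕ.< j → φ i ℕ.< φ j

strictAt-map⁺ : ∀ {φ} → StrictlyMonotone φ → ∀ {n} (S : Subset n) is →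
                StrictAt S is → StrictAt S (List.map φ is)
strictAt-map⁺ φ< []            is            _       = tt
strictAt-map⁺ φ< (inside  ∷ S) []            _       = tt
strictAt-map⁺ φ< (outside ∷ S) []            _       = tt
strictAt-map⁺ φ< (inside  ∷ S) (i ∷ [])      _       = tt
strictAt-map⁺ φ< (outside ∷ S) (i ∷ [])      _       = tt
strictAt-map⁺ φ< (inside  ∷ S) (i ∷ i′ ∷ is) (p , q) = φ< p , strictAt-map⁺ φ< S (i′ ∷ is) q
strictAt-map⁺ φ< (outside ∷ S) (i ∷ i′ ∷ is) q       = strictAt-map⁺ φ< S (i′ ∷ is) q

cancel-< : ∀ {φ} → StrictlyMonotone φ → ∀ {i j} → φ i ℕ.< φ j → i ℕ.< j
cancel-< φ< {i} {j} φi<φj with ℕ.<-cmp i j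
... | tri< i<j _ _  = i<j
... | tri≈ _ refl _ = contradiction φi<φj (ℕ.<-irrefl refl)
... | tri> _ _ j<i  = contradiction φi<φj (ℕ.<-asym (φ< j<i))

strictAt-map⁻ : ∀ {φ} → StrictlyMonotone φ → ∀ {n} (S : Subset n) is →
                StrictAt S (List.map φ is) → StrictAt S is
strictAt-map⁻ φ< []            is            _       = tt
strictAt-map⁻ φ< (inside  ∷ S) []            _       = tt
strictAt-map⁻ φ< (outside ∷ S) []            _       = tt
strictAt-map⁻ φ< (inside  ∷ S) (i ∷ [])      _       = tt
strictAt-map⁻ φ< (outside ∷ S) (i ∷ [])      _       = tt
strictAt-map⁻ φ< (inside  ∷ S) (i ∷ i′ ∷ is) (p , q) =
  cancel-< φ< p , strictAt-map⁻ φ< S (i′ ∷ is) q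
strictAt-map⁻ φ< (outside ∷ S) (i ∷ i′ ∷ is) q       = strictAt-map⁻ φ< S (i′ ∷ is) q

word-positives : ∀ m → ∃ λ φ → StrictlyMonotone φ × word m ≡ List.map φ (word (positives m))
word-positives []          = id , id , refl
word-positives (zero ∷ m)  with φ , φ< , eq ← word-positives m =
  suc ∘ φ , s≤s ∘ φ< , trans (cong (List.map suc) eq) (sym (List.map-∘ _))
word-positives (suc e ∷ m) with φ , φ< , eq ← word-positives m = φ⁺ , φ⁺< , (begin
  List.replicate (suc e) 0 ++ List.map suc (word m)
    ≡⟨ cong₂ _++_ (sym (List.map-replicate φ⁺ (suc e) 0)) (begin
      List.map suc (word m)              ≡⟨ cong (List.map suc) eq ⟩
      List.map suc (List.map φ w)        ≡⟨ List.map-∘ w ⟨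
      List.map (suc ∘ φ) w               ≡⟨ List.map-∘ w ⟩
      List.map φ⁺ (List.map suc w)       ∎) ⟩
  List.map φ⁺ (List.replicate (suc e) 0) ++ List.map φ⁺ (List.map suc w)
    ≡⟨ List.map-++ φ⁺ (List.replicate (suc e) 0) (List.map suc w) ⟨
  List.map φ⁺ (word (suc e ∷ positives m)) ∎)
  where
  open ≡-Reasoning
  w = word (positives m)

  φ⁺ : ℕ → ℕ
  φ⁺ zero    = zero
  φ⁺ (suc i) = suc (φ i)

  φ⁺< : StrictlyMonotone φ⁺
  φ⁺< {zero}  {suc j} _         = s≤s z≤n
  φ⁺< {suc i} {suc j} (s≤s i<j) = s≤s (φ< i<j)

strictAt-cong : ∀ {n} (S : Subset n) m m′ → positives m ≡ positives m′ →
                StrictAt S (word m) → StrictAt S (word m′)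
strictAt-cong S m m′ eq p
  with φ  , φ<  , w≡  ← word-positives m
     | φ′ , φ′< , w′≡ ← word-positives m′ =
  subst (StrictAt S) (sym w′≡) (strictAt-map⁺ φ′< S _
    (subst (StrictAt S ∘ word) eq
      (strictAt-map⁻ φ< S _ (subst (StrictAt S) w≡ p))))

sum-positives : ∀ m → sum m ≡ sum (positives m)
sum-positives []          = refl
sum-positives (zero ∷ m)  = sum-positives m
sum-positives (suc e ∷ m) = cong (suc e ℕ.+_) (sum-positives m)

sum-cong : ∀ m m′ → positives m ≡ positives m′ → sum m ≡ sum m′
sum-cong m m′ eq =
  trans (sum-positives m) (trans (cong sum eq) (sym (sum-positives m′)))

indicator : ∀ {P : Set} → Dec P → ℚ
indicator P? = if does P? then 1ℚ else 0ℚ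

indicator-false : ∀ {P : Set} (P? : Dec P) → ¬ P → indicator P? ≡ 0ℚ
indicator-false P? ¬p = cong (if_then 1ℚ else 0ℚ) (dec-false P? ¬p)

indicator-⇔ : ∀ {P Q : Set} (P? : Dec P) (Q? : Dec Q) → (P → Q) → (Q → P) →
              indicator P? ≡ indicator Q?
indicator-⇔ P? Q? f g = cong (if_then 1ℚ else 0ℚ) (does-⇔ (mk⇔ f g) P? Q?)

-- Distinct weakly increasing sequences have distinct monomials, so every
-- coefficient of F N S and of h r is 0 or 1.
-- For N = 0 the index set is Subset 0, and F 0 [] is the series 1.
F : ∀ N → Subset (N ∸ 1) → QSym N
F N S = record
  { coeff          = λ m → indicator (occurs? m)
  ; homogeneous    = λ m m≢ → indicator-false (occurs? m) (m≢ ∘ proj₁)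
  ; quasisymmetric = λ m m′ eq → indicator-⇔ (occurs? m) (occurs? m′)
      (occurs-cong m m′ eq) (occurs-cong m′ m (sym eq))
  }
  where
  Occurs : Monomial → Set
  Occurs m = sum m ≡ N × StrictAt S (word m)

  occurs? : ∀ m → Dec (Occurs m)
  occurs? m = sum m ℕ.≟ N ×-dec strictAt? S (word m)

  occurs-cong : ∀ m m′ → positives m ≡ positives m′ → Occurs m → Occurs m′
  occurs-cong m m′ eq (d , p) =
    trans (sym (sum-cong m m′ eq)) d , strictAt-cong S m m′ eq p

h : ∀ r → QSym r
h r = record
  { coeff          = λ m → indicator (sum m ℕ.≟ r)
  ; homogeneous    = λ m m≢ → indicator-false (sum m ℕ.≟ r) m≢
  ; quasisymmetric = λ m m′ eq → cong (λ d → indicator (d ℕ.≟ r)) (sum-cong m m′ eq)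
  }

record ℚ[x,y] : Set where
  field
    coeffᴾ : ℕ → ℕ → ℚ
    finite : ∃ λ d → ∀ a b → d ℕ.< a ℕ.+ b → coeffᴾ a b ≡ 0ℚ

open ℚ[x,y] public

infix  4 _≈ᴾ_
infixl 6 _+ᴾ_
infixr 7 _*ᴾ_
infix  8 -ᴾ_

_≈ᴾ_ : ℚ[x,y] → ℚ[x,y] → Set
p ≈ᴾ q = ∀ a b → coeffᴾ p a b ≡ coeffᴾ q a b

0ᴾ : ℚ[x,y]
0ᴾ = record { coeffᴾ = λ _ _ → 0ℚ ; finite = 0 , λ _ _ _ → refl }

1ᴾ : ℚ[x,y]
1ᴾ = record { coeffᴾ = c ; finite = 0 , c-finite }
  where
  c : ℕ → ℕ → ℚ
  c zero    zero    = 1ℚ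
  c zero    (suc _) = 0ℚ
  c (suc _) _       = 0ℚ

  c-finite : ∀ a b → 0 ℕ.< a ℕ.+ b → c a b ≡ 0ℚ
  c-finite zero    (suc _) _ = refl
  c-finite (suc _) _       _ = refl

_+ᴾ_ : ℚ[x,y] → ℚ[x,y] → ℚ[x,y]
p +ᴾ q with d , p-finite ← finite p | e , q-finite ← finite q = record
  { coeffᴾ = λ a b → coeffᴾ p a b ℚ.+ coeffᴾ q a b
  ; finite = d ⊔ e , λ a b d⊔e< → cong₂ ℚ._+_
      (p-finite a b (ℕ.≤-<-trans (ℕ.m≤m⊔n d e) d⊔e<))
      (q-finite a b (ℕ.≤-<-trans (ℕ.m≤n⊔m d e) d⊔e<))
  }

-ᴾ_ : ℚ[x,y] → ℚ[x,y]
-ᴾ p = record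
  { coeffᴾ = λ a b → ℚ.- coeffᴾ p a b
  ; finite = proj₁ (finite p) , λ a b d< → cong ℚ.-_ (proj₂ (finite p) a b d<)
  }

_*ᴾ_ : ℚ → ℚ[x,y] → ℚ[x,y]
c *ᴾ p = record
  { coeffᴾ = λ a b → c ℚ.* coeffᴾ p a b
  ; finite = proj₁ (finite p) , λ a b d< →
      trans (cong (c ℚ.*_) (proj₂ (finite p) a b d<)) (ℚ.*-zeroʳ c)
  }

ℚ[x,y]-rawLeftModule : RawLeftModule ℚ 0ℓ 0ℓ
ℚ[x,y]-rawLeftModule = record
  { Carrierᴹ = ℚ[x,y]
  ; _≈ᴹ_     = _≈ᴾ_
  ; _+ᴹ_     = _+ᴾ_
  ; _*ₗ_     = _*ᴾ_
  ; 0ᴹ       = 0ᴾ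
  ; -ᴹ_      = -ᴾ_
  }

open import Algebra.Definitions.RawMonoid (RawLeftModule.+ᴹ-rawMonoid ℚ[x,y]-rawLeftModule)
  using () renaming (sum to ∑ᴾ)

x·_ : ℚ[x,y] → ℚ[x,y]
x· p = record { coeffᴾ = c ; finite = suc (proj₁ (finite p)) , c-finite }
  where
  c : ℕ → ℕ → ℚ
  c zero    b = 0ℚ
  c (suc a) b = coeffᴾ p a b

  c-finite : ∀ a b → suc (proj₁ (finite p)) ℕ.< a ℕ.+ b → c a b ≡ 0ℚ
  c-finite zero    b _        = refl
  c-finite (suc a) b (s≤s d<) = proj₂ (finite p) a b d<

y·_ : ℚ[x,y] → ℚ[x,y]
y· p = record { coeffᴾ = c ; finite = suc (proj₁ (finite p)) , c-finite }
  where
  c : ℕ → ℕ → ℚ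
  c a zero    = 0ℚ
  c a (suc b) = coeffᴾ p a b

  c-finite : ∀ a b → suc (proj₁ (finite p)) ℕ.< a ℕ.+ b → c a b ≡ 0ℚ
  c-finite a zero    _  = refl
  c-finite a (suc b) d< = proj₂ (finite p) a b
    (ℕ.≤-pred (subst (suc (proj₁ (finite p)) ℕ.<_) (ℕ.+-suc a b) d<))

infixr 7 x^_·_ y^_·_

x^_·_ : ℕ → ℚ[x,y] → ℚ[x,y]
x^ n · p = fold p x·_ n

y^_·_ : ℕ → ℚ[x,y] → ℚ[x,y]
y^ n · p = fold p y·_ n

∂x : ℚ[x,y] → ℚ[x,y]
∂x p = record
  { coeffᴾ = λ a b → (+ suc a / 1) ℚ.* coeffᴾ p (suc a) b
  ; finite = proj₁ (finite p) , λ a b d< →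
      trans (cong ((+ suc a / 1) ℚ.*_) (proj₂ (finite p) (suc a) b (ℕ.m<n⇒m<1+n d<)))
            (ℚ.*-zeroʳ (+ suc a / 1))
  }

∂y : ℚ[x,y] → ℚ[x,y]
∂y p = record
  { coeffᴾ = λ a b → (+ suc b / 1) ℚ.* coeffᴾ p a (suc b)
  ; finite = proj₁ (finite p) , λ a b d< →
      trans (cong ((+ suc b / 1) ℚ.*_) (proj₂ (finite p) a (suc b)
              (subst (proj₁ (finite p) ℕ.<_) (sym (ℕ.+-suc a b)) (ℕ.m<n⇒m<1+n d<))))
            (ℚ.*-zeroʳ (+ suc b / 1))
  }

D : ℚ[x,y] → ℚ[x,y]
D p = ∂x p +ᴾ ∂y p

D^_·_ : ℕ → ℚ[x,y] → ℚ[x,y]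
D^ n · p = fold p D n

infixr 7 D^_·_

𝒢 : ℕ → ℚ[x,y] → ℚ[x,y]
𝒢 zero      p = p
𝒢 r@(suc _) p = y^ r · ∑ᴾ {r} λ i →
  let j = suc (toℕ i)
      instance _ = j ℕ.!≢0
  in (+ ((r ∸ 1) C (j ∸ 1)) / j !) *ᴾ x^ j · D^ j · p

-- For N = 0 this is x, the image of the series 1.
Φ-value : ∀ N → Subset (N ∸ 1) → ℚ[x,y]
Φ-value N S = x^ suc ∣ S ∣ · y^ (N ∸ ∣ S ∣) · 1ᴾ

record IsΦ (Φ : ∀ N → QSym N → ℚ[x,y]) : Set where
  open LeftModuleMorphisms using (IsLeftModuleHomomorphism)
  field
    linear : ∀ N →
      IsLeftModuleHomomorphism (QSym-rawLeftModule N) ℚ[x,y]-rawLeftModule (Φ N)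
    Φ-F    : ∀ N (S : Subset (N ∸ 1)) → Φ N (F N S) ≈ᴾ Φ-value N S

-- A family satisfying IsΦ exists: if a T is the coefficient of f at the
-- composition with set of partial sums T, then by inclusion–exclusion the
-- coordinate of f at the fundamental function of S is the alternating sum
-- Σ_{T ⊆ S} (-1)^{|S ∖ T|} a T, and expand a φ replaces that function by φ S.
expand : ∀ {n} → (Subset n → ℚ) → (Subset n → ℚ[x,y]) → ℚ[x,y]
expand {zero}  a φ = a [] *ᴾ φ []
expand {suc n} a φ =
  expand (a ∘ (outside ∷_)) (φ ∘ (outside ∷_)) +ᴾ
  expand (λ T → a (inside ∷ T) ℚ.- a (outside ∷ T)) (φ ∘ (inside ∷_))

expand-cong : ∀ {n} {a b : Subset n → ℚ} φ → a ≗ b → expand a φ ≈ᴾ expand b φ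
expand-cong {zero}  φ a≗b i j = cong (ℚ._* _) (a≗b [])
expand-cong {suc n} φ a≗b i j = cong₂ ℚ._+_
  (expand-cong (φ ∘ (outside ∷_)) (a≗b ∘ (outside ∷_)) i j)
  (expand-cong (φ ∘ (inside ∷_)) (λ T → cong₂ ℚ._-_ (a≗b (inside ∷ T)) (a≗b (outside ∷ T))) i j)

expand-+ : ∀ {n} (a b : Subset n → ℚ) φ →
           expand (λ T → a T ℚ.+ b T) φ ≈ᴾ expand a φ +ᴾ expand b φ
expand-+ {zero}  a b φ i j = ℚ.*-distribʳ-+ (coeffᴾ (φ []) i j) (a []) (b [])
expand-+ {suc n} a b φ i j = trans
  (cong₂ ℚ._+_
    (expand-+ (a ∘ (outside ∷_)) (b ∘ (outside ∷_)) (φ ∘ (outside ∷_)) i j)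
    (trans
      (expand-cong (φ ∘ (inside ∷_)) (λ T →
        solve 4 (λ p q r s → (p :+ q) :- (r :+ s) := (p :- r) :+ (q :- s)) refl
          (a (inside ∷ T)) (b (inside ∷ T)) (a (outside ∷ T)) (b (outside ∷ T))) i j)
      (expand-+ (λ T → a (inside ∷ T) ℚ.- a (outside ∷ T))
                (λ T → b (inside ∷ T) ℚ.- b (outside ∷ T)) (φ ∘ (inside ∷_)) i j)))
  (solve 4 (λ p q r s → (p :+ q) :+ (r :+ s) := (p :+ r) :+ (q :+ s)) refl
    (coeffᴾ (expand (a ∘ (outside ∷_)) (φ ∘ (outside ∷_))) i j)
    (coeffᴾ (expand (b ∘ (outside ∷_)) (φ ∘ (outside ∷_))) i j)
    (coeffᴾ (expand (λ T → a (inside ∷ T) ℚ.- a (outside ∷ T)) (φ ∘ (inside ∷_))) i j)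
    (coeffᴾ (expand (λ T → b (inside ∷ T) ℚ.- b (outside ∷ T)) (φ ∘ (inside ∷_))) i j))

expand-* : ∀ {n} c (a : Subset n → ℚ) φ →
           expand (λ T → c ℚ.* a T) φ ≈ᴾ c *ᴾ expand a φ
expand-* {zero}  c a φ i j = ℚ.*-assoc c (a []) _
expand-* {suc n} c a φ i j = trans
  (cong₂ ℚ._+_
    (expand-* c (a ∘ (outside ∷_)) (φ ∘ (outside ∷_)) i j)
    (trans
      (expand-cong (φ ∘ (inside ∷_)) (λ T →
        solve 3 (λ c p q → c :* p :- c :* q := c :* (p :- q)) refl
          c (a (inside ∷ T)) (a (outside ∷ T))) i j)
      (expand-* c (λ T → a (inside ∷ T) ℚ.- a (outside ∷ T)) (φ ∘ (inside ∷_)) i j)))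
  (sym (ℚ.*-distribˡ-+ c _ _))

expand-0 : ∀ {n} (φ : Subset n → ℚ[x,y]) → expand (λ _ → 0ℚ) φ ≈ᴾ 0ᴾ
expand-0 φ i j = trans (expand-* 0ℚ (λ _ → 0ℚ) φ i j) (ℚ.*-zeroˡ (coeffᴾ (expand (λ _ → 0ℚ) φ) i j))

-- comp S is the composition of n + 1 whose proper partial sums form S.
bump : List ℕ → List ℕ
bump []      = []
bump (e ∷ m) = suc e ∷ m

comp : ∀ {n} → Subset n → Monomial
comp []            = 1 ∷ []
comp (inside  ∷ S) = 1 ∷ comp S
comp (outside ∷ S) = bump (comp S)

data PositiveHead : List ℕ → Set where
  positiveHead : ∀ {e m} → PositiveHead (suc e ∷ m)

comp-positiveHead : ∀ {n} (S : Subset n) → PositiveHead (comp S)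
comp-positiveHead []            = positiveHead
comp-positiveHead (inside  ∷ S) = positiveHead
comp-positiveHead (outside ∷ S) with comp S | comp-positiveHead S
... | _ | positiveHead = positiveHead

sum-comp : ∀ {n} (S : Subset n) → sum (comp S) ≡ suc n
sum-comp []            = refl
sum-comp (inside  ∷ S) = cong suc (sum-comp S)
sum-comp (outside ∷ S) with comp S | comp-positiveHead S | sum-comp S
... | _ | positiveHead | eq = cong suc eq

-- The coefficient of F (suc n) U at comp T, which is 1 exactly when U ⊆ T.
χ : ∀ {n} → Subset n → Subset n → ℚ
χ U T = indicator (strictAt? U (word (comp T)))

χ-oo : ∀ {n} (U T : Subset n) → χ (outside ∷ U) (outside ∷ T) ≡ χ U T
χ-oo U T with comp T | comp-positiveHead T
... | _ | positiveHead = refl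

χ-io : ∀ {n} (U T : Subset n) → χ (inside ∷ U) (outside ∷ T) ≡ 0ℚ
χ-io U T with comp T | comp-positiveHead T
... | _ | positiveHead = refl

χ-oi : ∀ {n} (U T : Subset n) → χ (outside ∷ U) (inside ∷ T) ≡ χ U T
χ-oi U T with comp T | comp-positiveHead T
... | suc e ∷ m | positiveHead = indicator-⇔
  (strictAt? U (List.map suc (word (suc e ∷ m)))) (strictAt? U (word (suc e ∷ m)))
  (strictAt-map⁻ s≤s U _) (strictAt-map⁺ s≤s U _)

χ-ii : ∀ {n} (U T : Subset n) → χ (inside ∷ U) (inside ∷ T) ≡ χ U T
χ-ii U T with comp T | comp-positiveHead T
... | suc e ∷ m | positiveHead = indicator-⇔
  (strictAt? (inside ∷ U) (0 ∷ List.map suc (word (suc e ∷ m))))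
  (strictAt? U (word (suc e ∷ m)))
  (λ q → strictAt-map⁻ s≤s U _ (proj₂ q))
  (λ q → s≤s z≤n , strictAt-map⁺ s≤s U _ q)

expand-χ : ∀ {n} (U : Subset n) φ → expand (χ U) φ ≈ᴾ φ U
expand-χ []            φ i j = ℚ.*-identityˡ _
expand-χ (outside ∷ U) φ i j = trans
  (cong₂ ℚ._+_
    (trans (expand-cong (φ ∘ (outside ∷_)) (χ-oo U) i j)
           (expand-χ U (φ ∘ (outside ∷_)) i j))
    (trans (expand-cong (φ ∘ (inside ∷_)) (λ T →
             trans (cong₂ ℚ._-_ (χ-oi U T) (χ-oo U T)) (ℚ.+-inverseʳ (χ U T))) i j)
           (expand-0 (φ ∘ (inside ∷_)) i j)))
  (ℚ.+-identityʳ _)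
expand-χ (inside ∷ U)  φ i j = trans
  (cong₂ ℚ._+_
    (trans (expand-cong (φ ∘ (outside ∷_)) (χ-io U) i j)
           (expand-0 (φ ∘ (outside ∷_)) i j))
    (trans (expand-cong (φ ∘ (inside ∷_)) (λ T →
             trans (cong₂ ℚ._-_ (χ-ii U T) (χ-io U T)) (ℚ.+-identityʳ (χ U T))) i j)
           (expand-χ U (φ ∘ (inside ∷_)) i j)))
  (ℚ.+-identityˡ _)

mon : ∀ N → Subset (N ∸ 1) → Monomial
mon zero    S = []
mon (suc n) S = comp S

Φ₀ : ∀ N → QSym N → ℚ[x,y]
Φ₀ N f = expand (λ T → coeff f (mon N T)) (Φ-value N)

F-comp : ∀ n (U T : Subset n) → coeff (F (suc n) U) (comp T) ≡ χ U T
F-comp n U T = indicator-⇔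
  (sum (comp T) ℕ.≟ suc n ×-dec strictAt? U (word (comp T)))
  (strictAt? U (word (comp T)))
  proj₂ (sum-comp T ,_)

neg : ∀ x → ℚ.- x ≡ ℚ.- 1ℚ ℚ.* x
neg x = solve 1 (λ x → :- x := con (ℚ.- 1ℚ) :* x) refl x

isΦ₀ : IsΦ Φ₀
isΦ₀ = record
  { linear = λ N → record
    { +ᴹ-isGroupHomomorphism = record
      { isMonoidHomomorphism = record
        { isMagmaHomomorphism = record
          { isRelHomomorphism = record { cong = λ f≈g → expand-cong (Φ-value N) (f≈g ∘ mon N) }
          ; homo = λ f g → expand-+ (coeff f ∘ mon N) (coeff g ∘ mon N) (Φ-value N) }
        ; ε-homo = expand-0 (Φ-value N) }
      ; ⁻¹-homo = λ f i j → trans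
          (expand-cong (Φ-value N) (λ T → neg (coeff f (mon N T))) i j)
          (trans (expand-* (ℚ.- 1ℚ) (coeff f ∘ mon N) (Φ-value N) i j) (sym (neg (coeffᴾ (Φ₀ N f) i j)))) }
    ; *ₗ-homo = λ c f → expand-* c (coeff f ∘ mon N) (Φ-value N) }
  ; Φ-F = λ where
      zero    [] i j → ℚ.*-identityˡ _
      (suc n) U  i j → trans (expand-cong (Φ-value (suc n)) (F-comp n U) i j)
                             (expand-χ U (Φ-value (suc n)) i j)
  }

{-# OPTIONS --safe #-}

-- Put u = y − x, which D annihilates.  Passing to monomial quasisymmetric
-- functions gives, for N ≥ 1,
--   Φ f = y Ψ f,   Ψ f = Σ_α f(α) x^ℓ(α) u^(N−ℓ(α)),
-- the sum being over the compositions α of N.  Splitting off the first part of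
-- α in the coefficients of h_r f yields
--   Ψ (h_r f) = y Ψ (h_{r−1} f) + Σ_e x u^e Ψ (h_r f_e),
-- where f_e is the coefficient of z₁^(e+1) in f.  The operators satisfy the same
-- recursion, because they commute with u and
--   𝒢_r (x p) = y 𝒢_{r−1} (x p) + x 𝒢_r p,
-- which comes from [D, x] = 1 and Pascal's rule.  For N = 0 one has Φ f = x f
-- instead, which is harmless since D x = D y and 𝒢_r, r ≥ 1, sees only D p.
module Submission where

open import Defs
open import Data.Nat using (ℕ; _+_)

open import Algebra.Bundles using (Ring; CommutativeMonoid)
open import Algebra.Module.Bundles using (LeftSemimodule)
open import Algebra.Module.Bundles.Raw using (RawLeftModule)
open import Algebra.Module.Morphism.Structures using (module LeftModuleMorphisms)
open import Data.Fin.Base using (Fin; zero; suc; toℕ; fromℕ; inject₁)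
open import Data.Fin.Properties using (toℕ-fromℕ; toℕ-inject₁)
open import Data.Fin.Subset using (Subset; inside; outside; ∣_∣)
open import Data.Fin.Subset.Properties using (∣p∣≤n)
open import Data.Integer.Base as ℤ using (+_)
import Data.Integer.Properties as ℤ
open import Data.List.Base using ([]; _∷_)
open import Data.List.Properties using (filter-idem)
open import Data.Nat.Base using (zero; suc; _∸_; NonZero; ≢-nonZero; _!)
open import Data.Nat.Combinatorics using (_C_; nCk+nC[k+1]≡[n+1]C[k+1])
open import Data.Nat.Combinatorics.Specification using (k>n⇒nCk≡0)
open import Data.Nat.GeneralisedArithmetic using (fold)
open import Data.Nat.ListAction using () renaming (sum to sumℕ)
import Data.Nat.Properties as ℕ
open import Data.Product.Base using (∃; _,_)
open import Data.Rational.Base as ℚ using (ℚ; 0ℚ; 1ℚ; _/_; toℚᵘ)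
import Data.Rational.Properties as ℚ
open import Data.Rational.Solver using (module +-*-Solver)
import Data.Rational.Unnormalised.Base as ℚᵘ
import Data.Rational.Unnormalised.Properties as ℚᵘ
open import Data.Vec.Base using ([]; _∷_)
open import Function.Base using (_∘_)
open import Level using (0ℓ)
open import Relation.Binary.PropositionalEquality hiding (resp)
import Relation.Binary.Reasoning.Setoid as SetoidReasoning
open import Relation.Nullary using (yes; no)

open +-*-Solver using (solve; con; _:=_; _:+_; _:*_; _:-_)

open import Algebra.Properties.CommutativeMonoid.Sum ℚ.+-0-commutativeMonoid
  using () renaming (sum-cong-≗ to ∑-cong; sum-replicate-zero to ∑-zero)
open import Algebra.Definitions.RawMonoid (RawLeftModule.+ᴹ-rawMonoid ℚ[x,y]-rawLeftModule)
  using () renaming (sum to ∑ᴾ)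

-- Fractions in ℚ and inverse factorials

toℚᵘ-/ : ∀ i n .{{_ : NonZero n}} → toℚᵘ (i / n) ℚᵘ.≃ i ℚᵘ./ n
toℚᵘ-/ i (suc n) = ℚ.toℚᵘ-fromℚᵘ (ℚᵘ.mkℚᵘ i n)

-- Cross-multiplication: `_/_` normalises by a gcd and is stuck on variables, whereas unnormalised
-- fractions are compared by an integer equation.
/-*-/ : ∀ i j k m n o .{{_ : NonZero m}} .{{_ : NonZero n}} .{{_ : NonZero o}} →
        i ℤ.* j ℤ.* + o ≡ k ℤ.* (+ m ℤ.* + n) → (i / m) ℚ.* (j / n) ≡ k / o
/-*-/ i j k m@(suc _) n@(suc _) o@(suc _) eq = ℚ.toℚᵘ-injective (begin
  toℚᵘ ((i / m) ℚ.* (j / n))        ≈⟨ ℚ.toℚᵘ-homo-* (i / m) (j / n) ⟩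
  toℚᵘ (i / m) ℚᵘ.* toℚᵘ (j / n)    ≈⟨ ℚᵘ.*-cong (toℚᵘ-/ i m) (toℚᵘ-/ j n) ⟩
  (i ℚᵘ./ m) ℚᵘ.* (j ℚᵘ./ n)        ≈⟨ ℚᵘ.*≡* eq ⟩
  k ℚᵘ./ o                          ≈⟨ toℚᵘ-/ k o ⟨
  toℚᵘ (k / o)                      ∎)
  where open SetoidReasoning ℚᵘ.≃-setoid

ι : ℕ → ℚ
ι n = + n / 1

ι-+ : ∀ m n → ι (m + n) ≡ ι m ℚ.+ ι n
ι-+ m n = ℚ.toℚᵘ-injective (begin
  toℚᵘ (ι (m + n))                  ≈⟨ toℚᵘ-/ (+ (m + n)) 1 ⟩
  + (m + n) ℚᵘ./ 1                  ≈⟨ ℚᵘ.*≡* (cong (ℤ._* + 1)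
                                         (sym (cong₂ ℤ._+_ (ℤ.*-identityʳ (+ m)) (ℤ.*-identityʳ (+ n))))) ⟩
  (+ m ℚᵘ./ 1) ℚᵘ.+ (+ n ℚᵘ./ 1)    ≈⟨ ℚᵘ.+-cong (toℚᵘ-/ (+ m) 1) (toℚᵘ-/ (+ n) 1) ⟨
  toℚᵘ (ι m) ℚᵘ.+ toℚᵘ (ι n)        ≈⟨ ℚ.toℚᵘ-homo-+ (ι m) (ι n) ⟨
  toℚᵘ (ι m ℚ.+ ι n)                ∎)
  where open SetoidReasoning ℚᵘ.≃-setoid

/-split : ∀ m n .{{_ : NonZero n}} → + m / n ≡ ι m ℚ.* (+ 1 / n)
/-split m n = sym (/-*-/ (+ m) (+ 1) (+ m) 1 n n (trans (cong (ℤ._* + n) (ℤ.*-identityʳ (+ m)))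
  (cong (+ m ℤ.*_) (sym (ℤ.*-identityˡ (+ n))))))

1/_! : ℕ → ℚ
1/ n ! = (+ 1 / n !) {{n ℕ.!≢0}}

1/!-suc : ∀ n → ι (suc n) ℚ.* 1/ suc n ! ≡ 1/ n !
1/!-suc n = /-*-/ (+ suc n) (+ 1) (+ 1) 1 (suc n !) (n !) {{_}} {{suc n ℕ.!≢0}} {{n ℕ.!≢0}} (begin
  + suc n ℤ.* + 1 ℤ.* + (n !)  ≡⟨ cong (ℤ._* + (n !)) (ℤ.*-identityʳ (+ suc n)) ⟩
  + suc n ℤ.* + (n !)          ≡⟨ ℤ.pos-* (suc n) (n !) ⟨
  + (suc n !)                  ≡⟨ ℤ.*-identityˡ _ ⟨
  + 1 ℤ.* + (suc n !)          ≡⟨ ℤ.*-identityˡ _ ⟨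
  + 1 ℤ.* (+ 1 ℤ.* + (suc n !)) ∎)
  where open ≡-Reasoning


-- Multiplication of series by complete homogeneous functions

infix 8 h[_]*_

h[_]*_ : ℕ → Series → Series
h[ r ]* f = conv (coeff (h r)) f

h*-[] : ∀ f → (h[ 0 ]* f) [] ≡ f []
h*-[] f = ℚ.*-identityˡ (f [])

h*-0∷ : ∀ r {f} → IsQuasisymmetric f → ∀ m → (h[ r ]* f) (0 ∷ m) ≡ (h[ r ]* f) m
h*-0∷ r {f} qf m =
  conv-quasisymmetric {coeff (h r)} {f} (quasisymmetric (h r)) qf (0 ∷ m) m refl

-- Only the term that takes no z₁ from `h 0` survives: elsewhere the monomial taken from `h 0` has
-- positive degree, hence coefficient 0.
h₀* : ∀ f m → (h[ 0 ]* f) m ≡ f m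
h₀* f []      = h*-[] f
h₀* f (e ∷ m) = trans
  (cong₂ ℚ._+_ (h₀* (f ∘ (e ∷_)) m)
    (trans (∑-cong {e} λ k → conv-zero _ _ m λ a b _ →
      ℚ.*-zeroˡ (f (e ∸ suc (toℕ k) ∷ b))) (∑-zero e)))
  (ℚ.+-identityʳ (f (e ∷ m)))

h*-zero : ∀ r {f} → (∀ m → f m ≡ 0ℚ) → ∀ m → (h[ r ]* f) m ≡ 0ℚ
h*-zero r {f} f≡0 m = conv-zero (coeff (h r)) f m λ a b _ →
  trans (cong (coeff (h r) a ℚ.*_) (f≡0 b)) (ℚ.*-zeroʳ (coeff (h r) a))

-- The first summand collects the factorisations in which z₁ does not divide the
-- monomial taken from h.
h*-suc : ∀ r f e m →
  (h[ suc r ]* f) (suc e ∷ m) ≡ (h[ suc r ]* (f ∘ (suc e ∷_))) m ℚ.+ (h[ r ]* f) (e ∷ m)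
h*-suc r f e m = refl

-- Linear operators and binomial sums on a semimodule over ℚ

module LinearAlgebra (M : LeftSemimodule (Ring.semiring ℚ.+-*-ring) 0ℓ 0ℓ) where

  open LeftSemimodule M
  open import Algebra.Properties.CommutativeSemigroup
    (CommutativeMonoid.commutativeSemigroup +ᴹ-commutativeMonoid) using (interchange)
  open import Algebra.Properties.CommutativeMonoid.Sum +ᴹ-commutativeMonoid
    using (sum; sum-cong-≋; ∑-distrib-+; sum-init-last)
  open SetoidReasoning ≈ᴹ-setoid

  record IsLinear (L : Carrierᴹ → Carrierᴹ) : Set where
    field
      resp   : ∀ {p q} → p ≈ᴹ q → L p ≈ᴹ L q
      homo-+ : ∀ p q → L (p +ᴹ q) ≈ᴹ L p +ᴹ L q
      homo-* : ∀ c p → L (c *ₗ p) ≈ᴹ c *ₗ L p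

    -- Taken from homogeneity at the scalar 0, as addition in a semimodule need not be cancellable.
    homo-0 : L 0ᴹ ≈ᴹ 0ᴹ
    homo-0 = begin
      L 0ᴹ          ≈⟨ resp (*ₗ-zeroˡ 0ᴹ) ⟨
      L (0ℚ *ₗ 0ᴹ)  ≈⟨ homo-* 0ℚ 0ᴹ ⟩
      0ℚ *ₗ L 0ᴹ    ≈⟨ *ₗ-zeroˡ (L 0ᴹ) ⟩
      0ᴹ            ∎

  open IsLinear public

  id-linear : IsLinear (λ p → p)
  id-linear = record
    { resp   = λ e → e
    ; homo-+ = λ _ _ → ≈ᴹ-refl
    ; homo-* = λ _ _ → ≈ᴹ-refl
    }

  *-linear : ∀ c → IsLinear (c *ₗ_)
  *-linear c = record
    { resp   = *ₗ-congˡ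
    ; homo-+ = *ₗ-distribˡ c
    ; homo-* = λ d p → begin
        c *ₗ (d *ₗ p)     ≈⟨ *ₗ-assoc c d p ⟨
        (c ℚ.* d) *ₗ p    ≈⟨ *ₗ-congʳ (ℚ.*-comm c d) ⟩
        (d ℚ.* c) *ₗ p    ≈⟨ *ₗ-assoc d c p ⟩
        d *ₗ (c *ₗ p)     ∎
    }

  ∘-linear : ∀ {K L} → IsLinear K → IsLinear L → IsLinear (λ p → K (L p))
  ∘-linear {K} {L} lK lL = record
    { resp   = λ e → resp lK (resp lL e)
    ; homo-+ = λ p q → ≈ᴹ-trans (resp lK (homo-+ lL p q)) (homo-+ lK (L p) (L q))
    ; homo-* = λ c p → ≈ᴹ-trans (resp lK (homo-* lL c p)) (homo-* lK c (L p))
    }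

  +-linear : ∀ {K L} → IsLinear K → IsLinear L → IsLinear (λ p → K p +ᴹ L p)
  +-linear {K} {L} lK lL = record
    { resp   = λ e → +ᴹ-cong (resp lK e) (resp lL e)
    ; homo-+ = λ p q → ≈ᴹ-trans (+ᴹ-cong (homo-+ lK p q) (homo-+ lL p q))
        (interchange (K p) (K q) (L p) (L q))
    ; homo-* = λ c p → ≈ᴹ-trans (+ᴹ-cong (homo-* lK c p) (homo-* lL c p))
        (≈ᴹ-sym (*ₗ-distribˡ c (K p) (L p)))
    }

  ≈-linear : ∀ {K L} → (∀ p → K p ≈ᴹ L p) → IsLinear L → IsLinear K
  ≈-linear {K} {L} K≈L lL = record
    { resp   = λ {p} {q} e → ≈ᴹ-trans (K≈L p) (≈ᴹ-trans (resp lL e) (≈ᴹ-sym (K≈L q)))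
    ; homo-+ = λ p q → ≈ᴹ-trans (K≈L (p +ᴹ q)) (≈ᴹ-trans (homo-+ lL p q)
        (≈ᴹ-sym (+ᴹ-cong (K≈L p) (K≈L q))))
    ; homo-* = λ c p → ≈ᴹ-trans (K≈L (c *ₗ p)) (≈ᴹ-trans (homo-* lL c p)
        (≈ᴹ-sym (*ₗ-congˡ (K≈L p))))
    }

  fold-linear : ∀ {L} → IsLinear L → ∀ n → IsLinear (λ p → fold p L n)
  fold-linear lL zero    = id-linear
  fold-linear lL (suc n) = ∘-linear lL (fold-linear lL n)

  Commute : (K L : Carrierᴹ → Carrierᴹ) → Set
  Commute K L = ∀ p → K (L p) ≈ᴹ L (K p)

  fold-commute : ∀ {K L} → IsLinear L → Commute K L → ∀ n → Commute K (λ p → fold p L n)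
  fold-commute             lL KL zero    p = ≈ᴹ-refl
  fold-commute {K} {L = L} lL KL (suc n) p =
    ≈ᴹ-trans (KL (fold p L n)) (resp lL (fold-commute lL KL n p))

  -- Σ_i C(r, i) w_i, arranged so that Pascal's rule holds by computation.
  binomialSum : ℕ → (ℕ → Carrierᴹ) → Carrierᴹ
  binomialSum zero    w = w 0
  binomialSum (suc r) w = binomialSum r w +ᴹ binomialSum r (λ i → w (suc i))

  binomialSum-cong : ∀ r {v w} → (∀ i → v i ≈ᴹ w i) → binomialSum r v ≈ᴹ binomialSum r w
  binomialSum-cong zero    e = e 0
  binomialSum-cong (suc r) e = +ᴹ-cong (binomialSum-cong r e) (binomialSum-cong r λ i → e (suc i))

  binomialSum-+ : ∀ r v w →
                  binomialSum r (λ i → v i +ᴹ w i) ≈ᴹ binomialSum r v +ᴹ binomialSum r w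
  binomialSum-+ zero    v w = ≈ᴹ-refl
  binomialSum-+ (suc r) v w = ≈ᴹ-trans
    (+ᴹ-cong (binomialSum-+ r v w) (binomialSum-+ r (v ∘ suc) (w ∘ suc)))
    (interchange (binomialSum r v) (binomialSum r w)
                 (binomialSum r (v ∘ suc)) (binomialSum r (w ∘ suc)))

  binomialSum-homo : ∀ {L} → IsLinear L → ∀ r w →
                     binomialSum r (λ i → L (w i)) ≈ᴹ L (binomialSum r w)
  binomialSum-homo lL zero    w = ≈ᴹ-refl
  binomialSum-homo lL (suc r) w = ≈ᴹ-trans
    (+ᴹ-cong (binomialSum-homo lL r w) (binomialSum-homo lL r (w ∘ suc)))
    (≈ᴹ-sym (homo-+ lL (binomialSum r w) (binomialSum r (w ∘ suc))))

  binomialSum-linear : ∀ r {L : ℕ → Carrierᴹ → Carrierᴹ} → (∀ i → IsLinear (L i)) →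
                       IsLinear (λ p → binomialSum r λ i → L i p)
  binomialSum-linear zero    lL = lL 0
  binomialSum-linear (suc r) lL =
    +-linear (binomialSum-linear r lL) (binomialSum-linear r (λ i → lL (suc i)))

  -- Induction on r: Pascal's rule splits the sum for r + 1 into two sums for r, one of them
  -- shifted. This links the coefficients in `𝒢` to `binomialSum`.
  sum-binomial : ∀ r w →
    sum {suc r} (λ i → ι (r C toℕ i) *ₗ w (toℕ i)) ≈ᴹ binomialSum r w
  sum-binomial zero    w = ≈ᴹ-trans (+ᴹ-identityʳ _) (*ₗ-identityˡ (w 0))
  sum-binomial (suc r) w = begin
    -- The term at 0 is `high 0` because C(r + 1, 0) and C(r, 0) agree by computation.
    high 0 +ᴹ sum {suc r} (λ i → ι (suc r C suc (toℕ i)) *ₗ w (suc (toℕ i)))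
      ≈⟨ +ᴹ-congˡ (sum-cong-≋ {suc r} λ i → ≈ᴹ-trans
           (*ₗ-congʳ (trans (cong ι (sym (nCk+nC[k+1]≡[n+1]C[k+1] r (toℕ i))))
                            (ι-+ (r C toℕ i) (r C suc (toℕ i)))))
           (*ₗ-distribʳ (w (suc (toℕ i))) (ι (r C toℕ i)) (ι (r C suc (toℕ i))))) ⟩
    high 0 +ᴹ sum {suc r} (λ i → low (toℕ i) +ᴹ high (suc (toℕ i)))
      ≈⟨ +ᴹ-congˡ (≈ᴹ-trans
           (∑-distrib-+ {suc r} (λ i → low (toℕ i)) (λ i → high (suc (toℕ i))))
           (+ᴹ-comm _ _)) ⟩
    high 0 +ᴹ (sum {suc r} (λ i → high (suc (toℕ i))) +ᴹ sum {suc r} (λ i → low (toℕ i)))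
      -- Prefixing `high 0` makes the shifted sum one of r + 2 terms; its last term, with C(r, r +
      -- 1) = 0, is then dropped by `top`.
      ≈⟨ +ᴹ-assoc _ _ _ ⟨
    sum {suc (suc r)} (λ i → high (toℕ i)) +ᴹ sum {suc r} (λ i → low (toℕ i))
      ≈⟨ +ᴹ-congʳ (sum-init-last {suc r} (λ i → high (toℕ i))) ⟩
    (sum {suc r} (λ i → high (toℕ (inject₁ i))) +ᴹ high (toℕ (fromℕ (suc r))))
      +ᴹ sum {suc r} (λ i → low (toℕ i))
      ≈⟨ +ᴹ-congʳ (≈ᴹ-trans
           (+ᴹ-cong (sum-cong-≋ {suc r} λ i → ≈ᴹ-reflexive (cong high (toℕ-inject₁ i))) top)
           (+ᴹ-identityʳ _)) ⟩
    sum {suc r} (λ i → high (toℕ i)) +ᴹ sum {suc r} (λ i → low (toℕ i))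
      ≈⟨ +ᴹ-cong (sum-binomial r w) (sum-binomial r (w ∘ suc)) ⟩
    binomialSum (suc r) w ∎
    where
    low high : ℕ → Carrierᴹ
    low  i = ι (r C i) *ₗ w (suc i)
    high i = ι (r C i) *ₗ w i

    top : high (toℕ (fromℕ (suc r))) ≈ᴹ 0ᴹ
    top = begin
      high (toℕ (fromℕ (suc r)))  ≈⟨ ≈ᴹ-reflexive (cong high (toℕ-fromℕ (suc r))) ⟩
      ι (r C suc r) *ₗ w (suc r)  ≈⟨ *ₗ-congʳ (cong ι (k>n⇒nCk≡0 (ℕ.n<1+n r))) ⟩
      0ℚ *ₗ w (suc r)             ≈⟨ *ₗ-zeroˡ (w (suc r)) ⟩
      0ᴹ                          ∎

  -- y and u determine each other; both are fields because on ℚ[x,y] the operator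
  -- y is given and u has to be constructed by subtraction.
  record Operators : Set where
    field
      x y u ∂     : Carrierᴹ → Carrierᴹ
      x-linear    : IsLinear x
      y-linear    : IsLinear y
      u-linear    : IsLinear u
      ∂-linear    : IsLinear ∂
      y≈x+u       : ∀ p → y p ≈ᴹ x p +ᴹ u p
      xu          : Commute x u
      ∂-x          : ∀ p → ∂ (x p) ≈ᴹ x (∂ p) +ᴹ p
      ∂-u          : Commute ∂ u

  -- The operators 𝒢_r for an action of the Weyl algebra

  module WeylAction (ops : Operators) where

    open Operators ops

    xy : Commute x y
    xy p = begin
      x (y p)              ≈⟨ resp x-linear (y≈x+u p) ⟩
      x (x p +ᴹ u p)       ≈⟨ homo-+ x-linear (x p) (u p) ⟩
      x (x p) +ᴹ x (u p)   ≈⟨ +ᴹ-congˡ (xu p) ⟩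
      x (x p) +ᴹ u (x p)   ≈⟨ y≈x+u (x p) ⟨
      y (x p)              ∎

    uy : Commute u y
    uy p = begin
      u (y p)              ≈⟨ resp u-linear (y≈x+u p) ⟩
      u (x p +ᴹ u p)       ≈⟨ homo-+ u-linear (x p) (u p) ⟩
      u (x p) +ᴹ u (u p)   ≈⟨ +ᴹ-congʳ (xu p) ⟨
      x (u p) +ᴹ u (u p)   ≈⟨ y≈x+u (u p) ⟨
      y (u p)              ∎

    -- The difference `u p` contributes nothing, because ∂ commutes with u. This serves degree 0,
    -- where Φ has a factor x in place of y.
    y∂ : ∀ p → ∂ p ≈ᴹ 0ᴹ → ∂ (y p) ≈ᴹ ∂ (x p)
    y∂ p ∂p = begin
      ∂ (y p)              ≈⟨ resp ∂-linear (y≈x+u p) ⟩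
      ∂ (x p +ᴹ u p)       ≈⟨ homo-+ ∂-linear (x p) (u p) ⟩
      ∂ (x p) +ᴹ ∂ (u p)   ≈⟨ +ᴹ-congˡ (≈ᴹ-trans (∂-u p) (≈ᴹ-trans (resp u-linear ∂p) (homo-0 u-linear))) ⟩
      ∂ (x p) +ᴹ 0ᴹ        ≈⟨ +ᴹ-identityʳ (∂ (x p)) ⟩
      ∂ (x p)              ∎

    x^ y^ ∂^ : ℕ → Carrierᴹ → Carrierᴹ
    x^ n p = fold p x n
    y^ n p = fold p y n
    ∂^ n p = fold p ∂ n

    x^-linear : ∀ n → IsLinear (x^ n)
    x^-linear = fold-linear x-linear

    y^-linear : ∀ n → IsLinear (y^ n)
    y^-linear = fold-linear y-linear

    ∂^-linear : ∀ n → IsLinear (∂^ n)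
    ∂^-linear = fold-linear ∂-linear

    ∂∂^ : ∀ n → Commute ∂ (∂^ n)
    ∂∂^ = fold-commute {K = ∂} ∂-linear (λ _ → ≈ᴹ-refl)

    -- The relation [∂, x] = 1 iterates to [∂^n, x] = n ∂^(n-1); writing n = i + 1 avoids a
    -- predecessor.
    ∂^-x : ∀ i p → ∂^ (suc i) (x p) ≈ᴹ x (∂^ (suc i) p) +ᴹ ι (suc i) *ₗ ∂^ i p
    ∂^-x zero    p = ≈ᴹ-trans (∂-x p) (+ᴹ-congˡ (≈ᴹ-sym (*ₗ-identityˡ p)))
    ∂^-x (suc i) p = begin
      ∂ (∂^ (suc i) (x p))
        ≈⟨ resp ∂-linear (∂^-x i p) ⟩
      ∂ (x q +ᴹ ι (suc i) *ₗ ∂^ i p)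
        ≈⟨ homo-+ ∂-linear (x q) (ι (suc i) *ₗ ∂^ i p) ⟩
      ∂ (x q) +ᴹ ∂ (ι (suc i) *ₗ ∂^ i p)
        ≈⟨ +ᴹ-cong (∂-x q) (homo-* ∂-linear (ι (suc i)) (∂^ i p)) ⟩
      (x (∂ q) +ᴹ q) +ᴹ ι (suc i) *ₗ q
        ≈⟨ +ᴹ-assoc (x (∂ q)) q (ι (suc i) *ₗ q) ⟩
      x (∂ q) +ᴹ (q +ᴹ ι (suc i) *ₗ q)
        ≈⟨ +ᴹ-congˡ (+ᴹ-congʳ (*ₗ-identityˡ q)) ⟨
      x (∂ q) +ᴹ (1ℚ *ₗ q +ᴹ ι (suc i) *ₗ q)
        ≈⟨ +ᴹ-congˡ (*ₗ-distribʳ q 1ℚ (ι (suc i))) ⟨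
      x (∂ q) +ᴹ (1ℚ ℚ.+ ι (suc i)) *ₗ q
        ≈⟨ +ᴹ-congˡ (*ₗ-congʳ (ι-+ 1 (suc i))) ⟨
      x (∂ q) +ᴹ ι (suc (suc i)) *ₗ q ∎
      where q = ∂^ (suc i) p

    -- With the Euler operator θ = x ∂ this is the binomial coefficient C(θ, i), since x^i ∂^i is
    -- the falling factorial θ (θ - 1) ⋯ (θ - i + 1).
    δ : ℕ → Carrierᴹ → Carrierᴹ
    δ i p = 1/ i ! *ₗ x^ i (∂^ i p)

    δ-linear : ∀ i → IsLinear (δ i)
    δ-linear i = ∘-linear (*-linear (1/ i !)) (∘-linear (x^-linear i) (∂^-linear i))

    -- Pascal's rule for C(θ + 1, i + 1), as θ x = x (θ + 1). Concretely, the two terms of `∂^-x`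
    -- give `raise` and `lower`, and in the latter the factor i + 1 turns 1/(i + 1)! into 1/i!.
    δ-x : ∀ i p → δ (suc i) (x p) ≈ᴹ x (δ i p) +ᴹ x (δ (suc i) p)
    δ-x i p = begin
      c *ₗ x^ (suc i) (∂^ (suc i) (x p))
        ≈⟨ resp (∘-linear (*-linear c) (x^-linear (suc i))) (∂^-x i p) ⟩
      c *ₗ x^ (suc i) (x q +ᴹ ι (suc i) *ₗ ∂^ i p)
        ≈⟨ homo-+ (∘-linear (*-linear c) (x^-linear (suc i))) (x q) (ι (suc i) *ₗ ∂^ i p) ⟩
      c *ₗ x^ (suc i) (x q) +ᴹ c *ₗ x^ (suc i) (ι (suc i) *ₗ ∂^ i p)
        ≈⟨ +ᴹ-cong raise lower ⟩
      x (δ (suc i) p) +ᴹ x (δ i p)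
        ≈⟨ +ᴹ-comm (x (δ (suc i) p)) (x (δ i p)) ⟩
      x (δ i p) +ᴹ x (δ (suc i) p) ∎
      where
      c = 1/ suc i !
      q = ∂^ (suc i) p
      s = x^ i (∂^ i p)

      raise : c *ₗ x^ (suc i) (x q) ≈ᴹ x (c *ₗ x^ (suc i) q)
      raise = begin
        c *ₗ x^ (suc i) (x q)    ≈⟨ *ₗ-congˡ (fold-commute {K = x} x-linear (λ _ → ≈ᴹ-refl) (suc i) q) ⟨
        c *ₗ x (x^ (suc i) q)    ≈⟨ homo-* x-linear c (x^ (suc i) q) ⟨
        x (c *ₗ x^ (suc i) q)    ∎

      lower : c *ₗ x^ (suc i) (ι (suc i) *ₗ ∂^ i p) ≈ᴹ x (1/ i ! *ₗ s)
      lower = begin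
        c *ₗ x^ (suc i) (ι (suc i) *ₗ ∂^ i p)
          ≈⟨ *ₗ-congˡ (homo-* (x^-linear (suc i)) (ι (suc i)) (∂^ i p)) ⟩
        c *ₗ (ι (suc i) *ₗ x s)
          ≈⟨ *ₗ-assoc c (ι (suc i)) (x s) ⟨
        (c ℚ.* ι (suc i)) *ₗ x s
          ≈⟨ *ₗ-congʳ (trans (ℚ.*-comm c (ι (suc i))) (1/!-suc i)) ⟩
        1/ i ! *ₗ x s
          ≈⟨ homo-* x-linear (1/ i !) s ⟨
        x (1/ i ! *ₗ s) ∎

    uδ : ∀ i → Commute u (δ i)
    uδ i p = begin
      u (1/ i ! *ₗ x^ i (∂^ i p))
        ≈⟨ homo-* u-linear (1/ i !) (x^ i (∂^ i p)) ⟩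
      1/ i ! *ₗ u (x^ i (∂^ i p))
        ≈⟨ *ₗ-congˡ (fold-commute {K = u} x-linear (λ q → ≈ᴹ-sym (xu q)) i (∂^ i p)) ⟩
      1/ i ! *ₗ x^ i (u (∂^ i p))
        ≈⟨ *ₗ-congˡ (resp (x^-linear i) (fold-commute {K = u} ∂-linear (λ q → ≈ᴹ-sym (∂-u q)) i p)) ⟩
      1/ i ! *ₗ x^ i (∂^ i (u p)) ∎

    -- The index is positive, so one ∂ can be moved innermost, where it acts on the argument first.
    δ-suc-cong : ∀ i p q → ∂ p ≈ᴹ ∂ q → δ (suc i) p ≈ᴹ δ (suc i) q
    δ-suc-cong i p q e = resp (∘-linear (*-linear (1/ suc i !)) (x^-linear (suc i))) (begin
      ∂ (∂^ i p)  ≈⟨ ∂∂^ i p ⟩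
      ∂^ i (∂ p)  ≈⟨ resp (∂^-linear i) e ⟩
      ∂^ i (∂ q)  ≈⟨ ∂∂^ i q ⟨
      ∂ (∂^ i q)  ∎)

    -- Repeats the expression of `𝒢` over an abstract module; on ℚ[x,y] the summands coincide by
    -- computation.
    G : ℕ → Carrierᴹ → Carrierᴹ
    G zero      p = p
    G r@(suc _) p = y^ r (sum {r} λ i →
      let j = suc (toℕ i)
          instance _ = j ℕ.!≢0
      in (+ ((r ∸ 1) C (j ∸ 1)) / j !) *ₗ x^ j (∂^ j p))

    -- The factor of `G (suc r)` beside y^(r+1); the shift in δ comes from j = i + 1. By
    -- Vandermonde's identity it is C(θ + r, r + 1).
    S : ℕ → Carrierᴹ → Carrierᴹ
    S r p = binomialSum r λ i → δ (suc i) p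

    G-suc : ∀ r p → G (suc r) p ≈ᴹ y^ (suc r) (S r p)
    G-suc r p = resp (y^-linear (suc r)) (≈ᴹ-trans
      (sum-cong-≋ {suc r} λ i → let j = suc (toℕ i) in ≈ᴹ-trans
        (*ₗ-congʳ (/-split (r C toℕ i) (j !) {{j ℕ.!≢0}}))
        (*ₗ-assoc (ι (r C toℕ i)) (1/ j !) (x^ j (∂^ j p))))
      (sum-binomial r λ i → δ (suc i) p))

    S-linear : ∀ r → IsLinear (S r)
    S-linear r = binomialSum-linear r λ i → δ-linear (suc i)

    G-linear : ∀ r → IsLinear (G r)
    G-linear zero    = id-linear
    G-linear (suc r) = ≈-linear (G-suc r) (∘-linear (y^-linear (suc r)) (S-linear r))

    uG : ∀ r → Commute u (G r)
    uG zero    p = ≈ᴹ-refl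
    uG (suc r) p = begin
      u (G (suc r) p)
        ≈⟨ resp u-linear (G-suc r p) ⟩
      u (y^ (suc r) (S r p))
        ≈⟨ fold-commute {K = u} y-linear uy (suc r) (S r p) ⟩
      y^ (suc r) (u (S r p))
        ≈⟨ resp (y^-linear (suc r)) (binomialSum-homo u-linear r λ i → δ (suc i) p) ⟨
      y^ (suc r) (binomialSum r λ i → u (δ (suc i) p))
        ≈⟨ resp (y^-linear (suc r)) (binomialSum-cong r λ i → uδ (suc i) p) ⟩
      y^ (suc r) (S r (u p))
        ≈⟨ G-suc r (u p) ⟨
      G (suc r) (u p) ∎

    -- Every summand of `S` contains at least one ∂. In particular `G (suc r)` kills whatever ∂
    -- kills.
    G-suc-cong : ∀ r p q → ∂ p ≈ᴹ ∂ q → G (suc r) p ≈ᴹ G (suc r) q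
    G-suc-cong r p q e = begin
      G (suc r) p           ≈⟨ G-suc r p ⟩
      y^ (suc r) (S r p)    ≈⟨ resp (y^-linear (suc r)) (binomialSum-cong r λ i → δ-suc-cong i p q e) ⟩
      y^ (suc r) (S r q)    ≈⟨ G-suc r q ⟨
      G (suc r) q           ∎

    -- Apply `δ-x` to each summand of `S`. The halves that keep the index i + 1 add up to x times
    -- `G (suc r) p`; the halves with index i form `T`, which `lower` recognises as y times
    -- `G r (x p)`.
    G-x : ∀ r p → G (suc r) (x p) ≈ᴹ y (G r (x p)) +ᴹ x (G (suc r) p)
    G-x r p = begin
      G (suc r) (x p)
        ≈⟨ G-suc r (x p) ⟩
      y^ (suc r) (S r (x p))
        ≈⟨ resp (y^-linear (suc r)) (S-x r) ⟩
      y^ (suc r) (x (T r) +ᴹ x (S r p))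
        ≈⟨ homo-+ (y^-linear (suc r)) (x (T r)) (x (S r p)) ⟩
      y^ (suc r) (x (T r)) +ᴹ y^ (suc r) (x (S r p))
        ≈⟨ +ᴹ-cong (lower r) (≈ᴹ-sym (fold-commute {K = x} y-linear xy (suc r) (S r p))) ⟩
      y (G r (x p)) +ᴹ x (y^ (suc r) (S r p))
        ≈⟨ +ᴹ-congˡ (resp x-linear (G-suc r p)) ⟨
      y (G r (x p)) +ᴹ x (G (suc r) p) ∎
      where
      T : ℕ → Carrierᴹ
      T r = binomialSum r λ i → δ i p

      S-x : ∀ r → S r (x p) ≈ᴹ x (T r) +ᴹ x (S r p)
      S-x r = begin
        S r (x p)
          ≈⟨ binomialSum-cong r (λ i → δ-x i p) ⟩
        binomialSum r (λ i → x (δ i p) +ᴹ x (δ (suc i) p))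
          ≈⟨ binomialSum-+ r (λ i → x (δ i p)) (λ i → x (δ (suc i) p)) ⟩
        binomialSum r (λ i → x (δ i p)) +ᴹ binomialSum r (λ i → x (δ (suc i) p))
          ≈⟨ +ᴹ-cong (binomialSum-homo x-linear r λ i → δ i p)
                     (binomialSum-homo x-linear r λ i → δ (suc i) p) ⟩
        x (T r) +ᴹ x (S r p) ∎

      lower : ∀ r → y^ (suc r) (x (T r)) ≈ᴹ y (G r (x p))
      lower zero    = resp (∘-linear y-linear x-linear) (*ₗ-identityˡ p)
      -- Pascal's rule, built into `binomialSum`, unfolds `T (suc r)` to `T r +ᴹ S r p`, and x times
      -- that is `S r (x p)` by `S-x`.
      lower (suc r) = begin
        y (y^ (suc r) (x (T r +ᴹ S r p)))
          ≈⟨ resp (∘-linear y-linear (y^-linear (suc r))) (homo-+ x-linear (T r) (S r p)) ⟩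
        y (y^ (suc r) (x (T r) +ᴹ x (S r p)))
          ≈⟨ resp (∘-linear y-linear (y^-linear (suc r))) (S-x r) ⟨
        y (y^ (suc r) (S r (x p)))
          ≈⟨ resp y-linear (G-suc r (x p)) ⟨
        y (G (suc r) (x p)) ∎

    -- Sums over compositions and their behaviour under multiplication by h_r

    module Products (one : Carrierᴹ) (∂-one : ∂ one ≈ᴹ 0ᴹ) where

      tails : Series → ℕ → Series
      tails f e m = f (suc e ∷ m)

      -- Ψ n f sums f α x^ℓ u^(n − ℓ) over the compositions α of n, ℓ being the
      -- number of parts of α; in Ψ⁺ n g the first part is e + 1 with the weight
      -- u^e, its factor x being left out, and g e is evaluated at the other parts.
      Ψ  : ℕ → Series → Carrierᴹ
      Ψ⁺ : ℕ → (ℕ → Series) → Carrierᴹ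

      Ψ zero    f = f [] *ₗ one
      Ψ (suc n) f = x (Ψ⁺ n (tails f))

      Ψ⁺ zero    g = Ψ zero (g 0)
      Ψ⁺ (suc n) g = Ψ (suc n) (g 0) +ᴹ u (Ψ⁺ n (g ∘ suc))

      Ψ-cong  : ∀ n {f f′} → (∀ m → f m ≡ f′ m) → Ψ n f ≈ᴹ Ψ n f′
      Ψ⁺-cong : ∀ n {g g′} → (∀ e m → g e m ≡ g′ e m) → Ψ⁺ n g ≈ᴹ Ψ⁺ n g′

      Ψ-cong zero    f≗ = *ₗ-congʳ (f≗ [])
      Ψ-cong (suc n) f≗ = resp x-linear (Ψ⁺-cong n λ e m → f≗ (suc e ∷ m))

      Ψ⁺-cong zero    g≗ = Ψ-cong zero (g≗ 0)
      Ψ⁺-cong (suc n) g≗ =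
        +ᴹ-cong (Ψ-cong (suc n) (g≗ 0)) (resp u-linear (Ψ⁺-cong n (g≗ ∘ suc)))

      Ψ-+  : ∀ n f f′ → Ψ n (λ m → f m ℚ.+ f′ m) ≈ᴹ Ψ n f +ᴹ Ψ n f′
      Ψ⁺-+ : ∀ n g g′ → Ψ⁺ n (λ e m → g e m ℚ.+ g′ e m) ≈ᴹ Ψ⁺ n g +ᴹ Ψ⁺ n g′

      Ψ-+ zero    f f′ = *ₗ-distribʳ one (f []) (f′ [])
      Ψ-+ (suc n) f f′ = ≈ᴹ-trans (resp x-linear (Ψ⁺-+ n (tails f) (tails f′)))
        (homo-+ x-linear (Ψ⁺ n (tails f)) (Ψ⁺ n (tails f′)))

      Ψ⁺-+ zero    g g′ = Ψ-+ zero (g 0) (g′ 0)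
      Ψ⁺-+ (suc n) g g′ = ≈ᴹ-trans
        (+ᴹ-cong (Ψ-+ (suc n) (g 0) (g′ 0))
          (≈ᴹ-trans (resp u-linear (Ψ⁺-+ n (g ∘ suc) (g′ ∘ suc)))
            (homo-+ u-linear (Ψ⁺ n (g ∘ suc)) (Ψ⁺ n (g′ ∘ suc)))))
        (interchange _ _ _ _)

      Ψ-zero  : ∀ n {f} → (∀ m → f m ≡ 0ℚ) → Ψ n f ≈ᴹ 0ᴹ
      Ψ⁺-zero : ∀ n {g} → (∀ e m → g e m ≡ 0ℚ) → Ψ⁺ n g ≈ᴹ 0ᴹ

      Ψ-zero zero    f≡0 = ≈ᴹ-trans (*ₗ-congʳ (f≡0 [])) (*ₗ-zeroˡ one)
      Ψ-zero (suc n) f≡0 =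
        ≈ᴹ-trans (resp x-linear (Ψ⁺-zero n λ e m → f≡0 (suc e ∷ m))) (homo-0 x-linear)

      Ψ⁺-zero zero    g≡0 = Ψ-zero zero (g≡0 0)
      Ψ⁺-zero (suc n) g≡0 = ≈ᴹ-trans
        (+ᴹ-cong (Ψ-zero (suc n) (g≡0 0))
          (≈ᴹ-trans (resp u-linear (Ψ⁺-zero n (g≡0 ∘ suc))) (homo-0 u-linear)))
        (+ᴹ-identityˡ 0ᴹ)

      -- Used when `g` has total degree 0 but has been multiplied by h_r, so that n is arbitrary
      -- while only the entry at 0 survives.
      Ψ⁺-head : ∀ n g → (∀ e m → g (suc e) m ≡ 0ℚ) → Ψ⁺ n g ≈ᴹ Ψ n (g 0)
      Ψ⁺-head zero    g g≡0 = ≈ᴹ-refl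
      Ψ⁺-head (suc n) g g≡0 = ≈ᴹ-trans
        (+ᴹ-congˡ (≈ᴹ-trans (resp u-linear (Ψ⁺-zero n g≡0)) (homo-0 u-linear)))
        (+ᴹ-identityʳ (Ψ (suc n) (g 0)))

      Ψ⁺-∷ : ∀ n f → (∀ m → f (0 ∷ m) ≡ f m) →
             x (Ψ⁺ (suc n) (λ e m → f (e ∷ m))) ≈ᴹ y (Ψ (suc n) f)
      Ψ⁺-∷ n f f0∷ = begin
        x (Ψ (suc n) (f ∘ (0 ∷_)) +ᴹ u (Ψ⁺ n (tails f)))
          ≈⟨ homo-+ x-linear (Ψ (suc n) (f ∘ (0 ∷_))) (u (Ψ⁺ n (tails f))) ⟩
        x (Ψ (suc n) (f ∘ (0 ∷_))) +ᴹ x (u (Ψ⁺ n (tails f)))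
          ≈⟨ +ᴹ-cong (resp x-linear (Ψ-cong (suc n) f0∷)) (xu (Ψ⁺ n (tails f))) ⟩
        x (Ψ (suc n) f) +ᴹ u (Ψ (suc n) f)
          ≈⟨ y≈x+u (Ψ (suc n) f) ⟨
        y (Ψ (suc n) f) ∎

      Ψ-h*-suc : ∀ k r f →
        Ψ (suc k) (h[ suc r ]* f) ≈ᴹ
        x (Ψ⁺ k (λ e → h[ suc r ]* tails f e)) +ᴹ x (Ψ⁺ k (λ e m → (h[ r ]* f) (e ∷ m)))
      Ψ-h*-suc k r f = ≈ᴹ-trans
        (resp x-linear (≈ᴹ-trans (Ψ⁺-cong k (h*-suc r f))
          (Ψ⁺-+ k (λ e → h[ suc r ]* tails f e) (λ e m → (h[ r ]* f) (e ∷ m)))))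
        (homo-+ x-linear _ _)

      ∂-Ψ₀ : ∀ f → ∂ (Ψ 0 f) ≈ᴹ 0ᴹ
      ∂-Ψ₀ f = begin
        ∂ (f [] *ₗ one)   ≈⟨ homo-* ∂-linear (f []) one ⟩
        f [] *ₗ ∂ one     ≈⟨ *ₗ-congˡ ∂-one ⟩
        f [] *ₗ 0ᴹ        ≈⟨ *ₗ-zeroʳ (f []) ⟩
        0ᴹ                ∎

      -- Reconciles the general factor y with the factor x of Φ in degree 0.
      G-yΨ₀ : ∀ r .{{_ : NonZero r}} f → G r (y (Ψ 0 f)) ≈ᴹ G r (x (Ψ 0 f))
      G-yΨ₀ (suc r) f = G-suc-cong r (y (Ψ 0 f)) (x (Ψ 0 f)) (y∂ (Ψ 0 f) (∂-Ψ₀ f))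

      -- In `G-x` the second summand vanishes, because `G (suc r)` kills constants.
      G-xΨ₀ : ∀ r f → G (suc r) (x (Ψ 0 f)) ≈ᴹ y (G r (x (Ψ 0 f)))
      G-xΨ₀ r f = begin
        G (suc r) (x c)
          ≈⟨ G-x r c ⟩
        y (G r (x c)) +ᴹ x (G (suc r) c)
          ≈⟨ +ᴹ-congˡ (resp x-linear (≈ᴹ-trans
               (G-suc-cong r c 0ᴹ (≈ᴹ-trans (∂-Ψ₀ f) (≈ᴹ-sym (homo-0 ∂-linear))))
               (homo-0 (G-linear (suc r))))) ⟩
        y (G r (x c)) +ᴹ x 0ᴹ
          ≈⟨ +ᴹ-congˡ (homo-0 x-linear) ⟩
        y (G r (x c)) +ᴹ 0ᴹ
          ≈⟨ +ᴹ-identityʳ (y (G r (x c))) ⟩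
        y (G r (x c)) ∎
        where c = Ψ 0 f

      -- Both sides are x y^r applied to the constant `Ψ 0 f`. Homogeneity kills the tails of f, so
      -- z₁ must come from h; `rest` then lowers r by means of `Ψ⁺-∷`.
      Ψ₀-h*-suc : ∀ r f → IsQuasisymmetric f → IsHomogeneous 0 f →
                  Ψ (suc r) (h[ suc r ]* f) ≈ᴹ G r (x (Ψ 0 f))
      Ψ₀-h*-suc r f qf hf = ≈ᴹ-trans (Ψ-h*-suc r r f) (begin
        x (Ψ⁺ r (λ e → h[ suc r ]* tails f e)) +ᴹ x (Ψ⁺ r (λ e m → (h[ r ]* f) (e ∷ m)))
          ≈⟨ +ᴹ-congʳ (≈ᴹ-trans
               (resp x-linear (Ψ⁺-zero r λ e → h*-zero (suc r) λ m → hf (suc e ∷ m) λ ()))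
               (homo-0 x-linear)) ⟩
        0ᴹ +ᴹ x (Ψ⁺ r (λ e m → (h[ r ]* f) (e ∷ m)))
          ≈⟨ +ᴹ-identityˡ _ ⟩
        x (Ψ⁺ r (λ e m → (h[ r ]* f) (e ∷ m)))
          ≈⟨ rest r ⟩
        G r (x (Ψ 0 f)) ∎)
        where
        rest : ∀ r → x (Ψ⁺ r (λ e m → (h[ r ]* f) (e ∷ m))) ≈ᴹ G r (x (Ψ 0 f))
        rest zero    = resp x-linear (*ₗ-congʳ (trans (h*-0∷ 0 qf []) (h*-[] f)))
        rest (suc r) = begin
          x (Ψ⁺ (suc r) (λ e m → (h[ suc r ]* f) (e ∷ m)))
            ≈⟨ Ψ⁺-∷ r (h[ suc r ]* f) (h*-0∷ (suc r) qf) ⟩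
          y (Ψ (suc r) (h[ suc r ]* f))
            ≈⟨ resp y-linear (Ψ₀-h*-suc r f qf hf) ⟩
          y (G r (x (Ψ 0 f)))
            ≈⟨ G-xΨ₀ r f ⟨
          G (suc r) (x (Ψ 0 f)) ∎

      -- The left side unfolds by `Ψ-h*-suc` and the right side by `G-x`; the summands match by
      -- induction on n and r. The factor y is that of Φ = y Ψ.
      Ψ-h* : ∀ n r f → IsQuasisymmetric f → IsHomogeneous n f →
             y (Ψ (n + r) (h[ r ]* f)) ≈ᴹ G r (y (Ψ n f))
      -- The weights u^e are peeled off one at a time, as u commutes with y and with `G r`. The
      -- second hypothesis makes `g e` homogeneous of degree n - e and, being phrased by addition,
      -- zero for e > n.
      Ψ⁺-h* : ∀ n r g → (∀ e → IsQuasisymmetric (g e)) →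
              (∀ e m → e + sumℕ m ≢ n → g e m ≡ 0ℚ) →
              y (Ψ⁺ (n + r) (λ e → h[ r ]* g e)) ≈ᴹ G r (y (Ψ⁺ n g))

      Ψ-h* n       zero    f qf hf = resp y-linear (≈ᴹ-trans
        (≈ᴹ-reflexive (cong (λ k → Ψ k (h[ 0 ]* f)) (ℕ.+-identityʳ n)))
        (Ψ-cong n (h₀* f)))
      Ψ-h* zero    (suc r) f qf hf = begin
        y (Ψ (suc r) (h[ suc r ]* f))  ≈⟨ resp y-linear (Ψ₀-h*-suc r f qf hf) ⟩
        y (G r (x (Ψ 0 f)))            ≈⟨ G-xΨ₀ r f ⟨
        G (suc r) (x (Ψ 0 f))          ≈⟨ G-yΨ₀ (suc r) f ⟨
        G (suc r) (y (Ψ 0 f))          ∎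
      Ψ-h* (suc n) (suc r) f qf hf = begin
        y (Ψ (suc (n + suc r)) (h[ suc r ]* f))
          ≈⟨ resp y-linear (Ψ-h*-suc (n + suc r) r f) ⟩
        y (x (Ψ⁺ (n + suc r) (λ e → h[ suc r ]* tails f e)) +ᴹ x (Ψ⁺ (n + suc r) hf∷))
          ≈⟨ homo-+ y-linear _ _ ⟩
        y (x (Ψ⁺ (n + suc r) (λ e → h[ suc r ]* tails f e))) +ᴹ y (x (Ψ⁺ (n + suc r) hf∷))
          ≈⟨ +ᴹ-cong (≈ᴹ-trans (≈ᴹ-sym (xy _)) (resp x-linear IH⁺)) (resp y-linear IH) ⟩
        x (G (suc r) (y q)) +ᴹ y (G r (x (y q)))
          ≈⟨ +ᴹ-comm _ _ ⟩
        y (G r (x (y q))) +ᴹ x (G (suc r) (y q))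
          ≈⟨ G-x r (y q) ⟨
        G (suc r) (x (y q))
          ≈⟨ resp (G-linear (suc r)) (xy q) ⟩
        G (suc r) (y (x q)) ∎
        where
        q = Ψ⁺ n (tails f)
        hf∷ : ℕ → Series
        hf∷ e m = (h[ r ]* f) (e ∷ m)

        IH⁺ : y (Ψ⁺ (n + suc r) (λ e → h[ suc r ]* tails f e)) ≈ᴹ G (suc r) (y q)
        IH⁺ = Ψ⁺-h* n (suc r) (tails f) (λ e → quasisymmetric-∷ qf (suc e))
          (λ e m ≢n → hf (suc e ∷ m) (≢n ∘ ℕ.suc-injective))

        -- One z₁ has been taken from h, and the exponent of z₁ that is left may be 0. `Ψ⁺-∷`
        -- absorbs it into a factor y, so the induction hypothesis for r applies to the same f.
        IH : x (Ψ⁺ (n + suc r) hf∷) ≈ᴹ G r (x (y q))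
        IH = begin
          x (Ψ⁺ (n + suc r) hf∷)         ≈⟨ ≈ᴹ-reflexive (cong (λ k → x (Ψ⁺ k hf∷)) (ℕ.+-suc n r)) ⟩
          x (Ψ⁺ (suc (n + r)) hf∷)       ≈⟨ Ψ⁺-∷ (n + r) (h[ r ]* f) (h*-0∷ r qf) ⟩
          y (Ψ (suc (n + r)) (h[ r ]* f)) ≈⟨ Ψ-h* (suc n) r f qf hf ⟩
          G r (y (x q))                  ≈⟨ resp (G-linear r) (xy q) ⟨
          G r (x (y q))                  ∎

      Ψ⁺-h* zero    r g qg hg = ≈ᴹ-trans
        (resp y-linear (Ψ⁺-head r (λ e → h[ r ]* g e) λ e → h*-zero r λ m → hg (suc e) m λ ()))
        (Ψ-h* zero r (g 0) (qg 0) (hg 0))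
      Ψ⁺-h* (suc n) r g qg hg = begin
        y (Ψ (suc n + r) (h[ r ]* g 0) +ᴹ u p)
          ≈⟨ homo-+ y-linear (Ψ (suc n + r) (h[ r ]* g 0)) (u p) ⟩
        y (Ψ (suc n + r) (h[ r ]* g 0)) +ᴹ y (u p)
          ≈⟨ +ᴹ-cong (Ψ-h* (suc n) r (g 0) (qg 0) (hg 0)) (≈ᴹ-trans (≈ᴹ-sym (uy p))
               (resp u-linear (Ψ⁺-h* n r (g ∘ suc) (qg ∘ suc)
                 (λ e m ≢n → hg (suc e) m (≢n ∘ ℕ.suc-injective))))) ⟩
        G r (y (Ψ (suc n) (g 0))) +ᴹ u (G r (y q))
          ≈⟨ +ᴹ-congˡ (≈ᴹ-trans (uG r (y q)) (resp (G-linear r) (uy q))) ⟩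
        G r (y (Ψ (suc n) (g 0))) +ᴹ G r (y (u q))
          ≈⟨ homo-+ (∘-linear (G-linear r) y-linear) (Ψ (suc n) (g 0)) (u q) ⟨
        G r (y (Ψ (suc n) (g 0) +ᴹ u q)) ∎
        where
        p = Ψ⁺ (n + r) (λ e → h[ r ]* g (suc e))
        q = Ψ⁺ n (g ∘ suc)

-- The polynomial ring with its operators as an instance

ℚ[x,y]-leftSemimodule : LeftSemimodule (Ring.semiring ℚ.+-*-ring) 0ℓ 0ℓ
ℚ[x,y]-leftSemimodule = record
  { Carrierᴹ = ℚ[x,y]
  ; _≈ᴹ_ = _≈ᴾ_
  ; _+ᴹ_ = _+ᴾ_
  ; _*ₗ_ = _*ᴾ_
  ; 0ᴹ   = 0ᴾ
  ; isLeftSemimodule = record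
    { +ᴹ-isCommutativeMonoid = record
      { isMonoid = record
        { isSemigroup = record
          { isMagma = record
            { isEquivalence = record
              { refl  = λ a b → refl
              ; sym   = λ e a b → sym (e a b)
              ; trans = λ e e′ a b → trans (e a b) (e′ a b)
              }
            ; ∙-cong = λ e e′ a b → cong₂ ℚ._+_ (e a b) (e′ a b)
            }
          ; assoc = λ p q r a b → ℚ.+-assoc (coeffᴾ p a b) (coeffᴾ q a b) (coeffᴾ r a b)
          }
        ; identity = (λ p a b → ℚ.+-identityˡ (coeffᴾ p a b))
                   , (λ p a b → ℚ.+-identityʳ (coeffᴾ p a b))
        }
      ; comm = λ p q a b → ℚ.+-comm (coeffᴾ p a b) (coeffᴾ q a b)
      }
    ; isPreleftSemimodule = record
      { *ₗ-cong      = λ c≡d e a b → cong₂ ℚ._*_ c≡d (e a b)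
      ; *ₗ-zeroˡ     = λ p a b → ℚ.*-zeroˡ (coeffᴾ p a b)
      ; *ₗ-distribʳ  = λ p c d a b → ℚ.*-distribʳ-+ (coeffᴾ p a b) c d
      ; *ₗ-identityˡ = λ p a b → ℚ.*-identityˡ (coeffᴾ p a b)
      ; *ₗ-assoc     = λ c d p a b → ℚ.*-assoc c d (coeffᴾ p a b)
      ; *ₗ-zeroʳ     = λ c a b → ℚ.*-zeroʳ c
      ; *ₗ-distribˡ  = λ c p q a b → ℚ.*-distribˡ-+ c (coeffᴾ p a b) (coeffᴾ q a b)
      }
    }
  }

open LinearAlgebra ℚ[x,y]-leftSemimodule
open import Algebra.Definitions.RawMonoid (LeftSemimodule.+ᴹ-rawMonoid ℚ[x,y]-leftSemimodule)
  using (sum)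

x·-linear : IsLinear x·_
x·-linear = record
  { resp   = λ { e zero b → refl ; e (suc a) b → e a b }
  ; homo-+ = λ { p q zero b → refl ; p q (suc a) b → refl }
  ; homo-* = λ { c p zero b → sym (ℚ.*-zeroʳ c) ; c p (suc a) b → refl }
  }

y·-linear : IsLinear y·_
y·-linear = record
  { resp   = λ { e a zero → refl ; e a (suc b) → e a b }
  ; homo-+ = λ { p q a zero → refl ; p q a (suc b) → refl }
  ; homo-* = λ { c p a zero → sym (ℚ.*-zeroʳ c) ; c p a (suc b) → refl }
  }

∂x-linear : IsLinear ∂x
∂x-linear = record
  { resp   = λ e a b → cong (ι (suc a) ℚ.*_) (e (suc a) b)
  ; homo-+ = λ p q a b → ℚ.*-distribˡ-+ (ι (suc a)) (coeffᴾ p (suc a) b) (coeffᴾ q (suc a) b)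
  ; homo-* = λ c p a b → solve 3 (λ c d p → c :* (d :* p) := d :* (c :* p)) refl
      (ι (suc a)) c (coeffᴾ p (suc a) b)
  }

∂y-linear : IsLinear ∂y
∂y-linear = record
  { resp   = λ e a b → cong (ι (suc b) ℚ.*_) (e a (suc b))
  ; homo-+ = λ p q a b → ℚ.*-distribˡ-+ (ι (suc b)) (coeffᴾ p a (suc b)) (coeffᴾ q a (suc b))
  ; homo-* = λ c p a b → solve 3 (λ c d p → c :* (d :* p) := d :* (c :* p)) refl
      (ι (suc b)) c (coeffᴾ p a (suc b))
  }

u·_ : ℚ[x,y] → ℚ[x,y]
u· p = y· p +ᴾ (ℚ.- 1ℚ) *ᴾ (x· p)

D-x : ∀ p → D (x· p) ≈ᴾ x· (D p) +ᴾ p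
D-x p zero    b = solve 2 (λ p c → con 1ℚ :* p :+ c :* con 0ℚ := con 0ℚ :+ p) refl
  (coeffᴾ p zero b) (ι (suc b))
D-x p (suc a) b = trans
  (cong (λ c → c ℚ.* coeffᴾ p (suc a) b ℚ.+ ι (suc b) ℚ.* coeffᴾ p a (suc b)) (ι-+ 1 (suc a)))
  (solve 4 (λ c d p q → (con 1ℚ :+ c) :* p :+ d :* q := (c :* p :+ d :* q) :+ p) refl
    (ι (suc a)) (ι (suc b)) (coeffᴾ p (suc a) b) (coeffᴾ p a (suc b)))

D-y : ∀ p → D (y· p) ≈ᴾ y· (D p) +ᴾ p
D-y p a zero    = solve 2 (λ p c → c :* con 0ℚ :+ con 1ℚ :* p := con 0ℚ :+ p) refl
  (coeffᴾ p a zero) (ι (suc a))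
D-y p a (suc b) = trans
  (cong (λ c → ι (suc a) ℚ.* coeffᴾ p (suc a) b ℚ.+ c ℚ.* coeffᴾ p a (suc b)) (ι-+ 1 (suc b)))
  (solve 4 (λ c d p q → c :* p :+ (con 1ℚ :+ d) :* q := (c :* p :+ d :* q) :+ q) refl
    (ι (suc a)) (ι (suc b)) (coeffᴾ p (suc a) b) (coeffᴾ p a (suc b)))

-- The Leibniz terms `p` in `D-y` and `D-x` cancel.
D-u : ∀ p → D (u· p) ≈ᴾ u· (D p)
D-u p a b = begin
  coeffᴾ (D (u· p)) a b
    ≡⟨ solve 6 (λ c d y₁ x₁ y₂ x₂ →
         c :* (y₁ :+ con (ℚ.- 1ℚ) :* x₁) :+ d :* (y₂ :+ con (ℚ.- 1ℚ) :* x₂) :=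
         (c :* y₁ :+ d :* y₂) :+ con (ℚ.- 1ℚ) :* (c :* x₁ :+ d :* x₂)) refl
         (ι (suc a)) (ι (suc b)) (coeffᴾ (y· p) (suc a) b) (coeffᴾ (x· p) (suc a) b)
         (coeffᴾ (y· p) a (suc b)) (coeffᴾ (x· p) a (suc b)) ⟩
  coeffᴾ (D (y· p)) a b ℚ.+ ℚ.- 1ℚ ℚ.* coeffᴾ (D (x· p)) a b
    ≡⟨ cong₂ (λ s t → s ℚ.+ ℚ.- 1ℚ ℚ.* t) (D-y p a b) (D-x p a b) ⟩
  (coeffᴾ (y· (D p)) a b ℚ.+ coeffᴾ p a b) ℚ.+ ℚ.- 1ℚ ℚ.* (coeffᴾ (x· (D p)) a b ℚ.+ coeffᴾ p a b)
    ≡⟨ solve 3 (λ y x p → (y :+ p) :+ con (ℚ.- 1ℚ) :* (x :+ p) := y :+ con (ℚ.- 1ℚ) :* x) refl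
         (coeffᴾ (y· (D p)) a b) (coeffᴾ (x· (D p)) a b) (coeffᴾ p a b) ⟩
  coeffᴾ (u· (D p)) a b ∎
  where open ≡-Reasoning

polynomialOperators : Operators
polynomialOperators = record
  { x = x·_
  ; y = y·_
  ; u = u·_
  ; ∂ = D
  ; x-linear = x·-linear
  ; y-linear = y·-linear
  ; u-linear = +-linear y·-linear (∘-linear (*-linear (ℚ.- 1ℚ)) x·-linear)
  ; ∂-linear = +-linear ∂x-linear ∂y-linear
  ; y≈x+u = λ p a b → solve 2 (λ x y → y := x :+ (y :+ con (ℚ.- 1ℚ) :* x)) refl
      (coeffᴾ (x· p) a b) (coeffᴾ (y· p) a b)
  ; xu = λ { p zero    zero    → refl
           ; p zero    (suc b) → refl
           ; p (suc a) zero    → refl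
           ; p (suc a) (suc b) → refl }
  ; ∂-x = D-x
  ; ∂-u = D-u
  }

D-1 : D 1ᴾ ≈ᴾ 0ᴾ
D-1 a b = cong₂ ℚ._+_ (ℚ.*-zeroʳ (ι (suc a)))
  (trans (cong (ι (suc b) ℚ.*_) (c≡0 a)) (ℚ.*-zeroʳ (ι (suc b))))
  where
  c≡0 : ∀ a → coeffᴾ 1ᴾ a (suc b) ≡ 0ℚ
  c≡0 zero    = refl
  c≡0 (suc a) = refl

open WeylAction polynomialOperators using (xy; uy; y^-linear; G; G-linear; module Products)
open Products 1ᴾ D-1

∑ᴾ-cong : ∀ n {s t} → (∀ i → s i ≈ᴾ t i) → ∑ᴾ {n} s ≈ᴾ sum {n} t
∑ᴾ-cong zero    e a b = refl
∑ᴾ-cong (suc n) e a b = cong₂ ℚ._+_ (e zero a b) (∑ᴾ-cong n (λ i → e (suc i)) a b)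

𝒢≈G : ∀ r p → 𝒢 r p ≈ᴾ G r p
𝒢≈G zero    p a b = refl
𝒢≈G (suc r) p = resp (y^-linear (suc r)) {∑ᴾ {suc r} term} (∑ᴾ-cong (suc r) {term} {term} λ i a b → refl)
  where
  term : Fin (suc r) → ℚ[x,y]
  term i =
    let j = suc (toℕ i)
        instance _ = j ℕ.!≢0
    in (+ ((suc r ∸ 1) C (j ∸ 1)) / j !) *ᴾ x^ j · D^ j · p

-- From fundamental to monomial coefficients: `Φ₀` in terms of Ψ

expand-resp : ∀ {n} (a : Subset n → ℚ) {φ ψ} → (∀ S → φ S ≈ᴾ ψ S) → expand a φ ≈ᴾ expand a ψ
expand-resp {zero}  a e i j = cong (a [] ℚ.*_) (e [] i j)
expand-resp {suc n} a e i j = cong₂ ℚ._+_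
  (expand-resp (a ∘ (outside ∷_)) (e ∘ (outside ∷_)) i j)
  (expand-resp (λ T → a (inside ∷ T) ℚ.- a (outside ∷ T)) (e ∘ (inside ∷_)) i j)

expand-homo : ∀ {L} → IsLinear L → ∀ {n} (a : Subset n → ℚ) φ →
              expand a (λ S → L (φ S)) ≈ᴾ L (expand a φ)
expand-homo {L} lL {zero}  a φ i j = sym (homo-* lL (a []) (φ []) i j)
expand-homo {L} lL {suc n} a φ i j = trans
  (cong₂ ℚ._+_ (expand-homo lL (a ∘ (outside ∷_)) (φ ∘ (outside ∷_)) i j)
               (expand-homo lL a′ (φ ∘ (inside ∷_)) i j))
  (sym (homo-+ lL (expand (a ∘ (outside ∷_)) (φ ∘ (outside ∷_))) (expand a′ (φ ∘ (inside ∷_))) i j))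
  where a′ = λ T → a (inside ∷ T) ℚ.- a (outside ∷ T)

expand-- : ∀ {n} (a b : Subset n → ℚ) φ →
           expand (λ T → a T ℚ.- b T) φ ≈ᴾ expand a φ +ᴾ (ℚ.- 1ℚ) *ᴾ expand b φ
expand-- a b φ i j = begin
  coeffᴾ (expand (λ T → a T ℚ.- b T) φ) i j
    ≡⟨ expand-cong φ (λ T → cong (a T ℚ.+_) (neg (b T))) i j ⟩
  coeffᴾ (expand (λ T → a T ℚ.+ (ℚ.- 1ℚ) ℚ.* b T) φ) i j
    ≡⟨ expand-+ a (λ T → (ℚ.- 1ℚ) ℚ.* b T) φ i j ⟩
  coeffᴾ (expand a φ) i j ℚ.+ coeffᴾ (expand (λ T → (ℚ.- 1ℚ) ℚ.* b T) φ) i j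
    ≡⟨ cong (coeffᴾ (expand a φ) i j ℚ.+_) (expand-* (ℚ.- 1ℚ) b φ i j) ⟩
  coeffᴾ (expand a φ +ᴾ (ℚ.- 1ℚ) *ᴾ expand b φ) i j ∎
  where open ≡-Reasoning

-- Φ-value (suc n) S without one factor x.
value : ∀ n → Subset n → ℚ[x,y]
value n S = x^ ∣ S ∣ · y^ (suc n ∸ ∣ S ∣) · 1ᴾ

value-outside : ∀ n S → value (suc n) (outside ∷ S) ≈ᴾ y· (value n S)
value-outside n S i j = trans
  (cong (λ k → coeffᴾ (x^ ∣ S ∣ · y^ k · 1ᴾ) i j)
    -- Since S has at most n + 1 elements, the truncated subtraction is exact and one factor y
    -- splits off.
    (ℕ.+-∸-assoc 1 (ℕ.m≤n⇒m≤1+n (∣p∣≤n S))))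
  (sym (fold-commute {y·_} x·-linear (λ p a b → sym (xy p a b)) ∣ S ∣ (y^ (suc n ∸ ∣ S ∣) · 1ᴾ) i j))

-- Let A collect the compositions with an initial part 1 split off and B those with the first part
-- enlarged. The alternating sum yields y B + x (A - B), which regroups to x A + u B, the recursion
-- of `Ψ⁺`.
expand-value : ∀ n f → expand (f ∘ comp) (value n) ≈ᴾ y· (Ψ⁺ n (tails f))
expand-value zero    f i j = sym (homo-* y·-linear (f (1 ∷ [])) 1ᴾ i j)
expand-value (suc n) f i j = begin
  coeffᴾ (expand (f ∘ bump ∘ comp) (value (suc n) ∘ (outside ∷_))) i j ℚ.+
  coeffᴾ (expand (λ T → f (1 ∷ comp T) ℚ.- f (bump (comp T))) (λ S → x· (value n S))) i j
    ≡⟨ cong₂ ℚ._+_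
         (trans (expand-resp (f ∘ bump ∘ comp) (value-outside n) i j)
                (expand-homo y·-linear (f ∘ bump ∘ comp) (value n) i j))
         (trans (expand-homo x·-linear (λ T → f (1 ∷ comp T) ℚ.- f (bump (comp T))) (value n) i j)
           (trans (resp x·-linear (expand-- (f ∘ (1 ∷_) ∘ comp) (f ∘ bump ∘ comp) (value n)) i j)
             (trans (homo-+ x·-linear A ((ℚ.- 1ℚ) *ᴾ B) i j)
               (cong (coeffᴾ (x· A) i j ℚ.+_) (homo-* x·-linear (ℚ.- 1ℚ) B i j))))) ⟩
  coeffᴾ (y· B) i j ℚ.+ (coeffᴾ (x· A) i j ℚ.+ ℚ.- 1ℚ ℚ.* coeffᴾ (x· B) i j)
    ≡⟨ solve 3 (λ y a x → y :+ (a :+ con (ℚ.- 1ℚ) :* x) := a :+ (y :+ con (ℚ.- 1ℚ) :* x)) refl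
         (coeffᴾ (y· B) i j) (coeffᴾ (x· A) i j) (coeffᴾ (x· B) i j) ⟩
  coeffᴾ (x· A) i j ℚ.+ coeffᴾ (u· B) i j
    -- The second induction hypothesis fits because `tails (f ∘ bump)` computes to `tails f ∘ suc`.
    ≡⟨ cong₂ ℚ._+_
         (trans (resp x·-linear (expand-value n (f ∘ (1 ∷_))) i j) (xy A⁺ i j))
         (trans (resp u·-linear (expand-value n (f ∘ bump)) i j) (uy B⁺ i j)) ⟩
  coeffᴾ (y· (x· A⁺)) i j ℚ.+ coeffᴾ (y· (u· B⁺)) i j
    ≡⟨ homo-+ y·-linear (x· A⁺) (u· B⁺) i j ⟨
  coeffᴾ (y· (x· A⁺ +ᴾ u· B⁺)) i j ∎
  where
  open ≡-Reasoning
  open Operators polynomialOperators using () renaming (u-linear to u·-linear)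
  A  = expand (f ∘ (1 ∷_) ∘ comp) (value n)
  B  = expand (f ∘ bump ∘ comp) (value n)
  A⁺ = Ψ⁺ n (tails (f ∘ (1 ∷_)))
  B⁺ = Ψ⁺ n (tails f ∘ suc)

Φ₀-Ψ : ∀ N .{{_ : NonZero N}} (f : QSym N) → Φ₀ N f ≈ᴾ y· (Ψ N (coeff f))
Φ₀-Ψ (suc n) f i j = trans (expand-homo x·-linear (coeff f ∘ comp) (value n) i j)
  (trans (resp x·-linear (expand-value n (coeff f)) i j) (xy (Ψ⁺ n (tails (coeff f))) i j))

Φ₀-zero : ∀ f → Φ₀ 0 f ≈ᴾ x· (Ψ 0 (coeff f))
Φ₀-zero f i j = sym (homo-* x·-linear (coeff f []) 1ᴾ i j)

-- For N = 0 the right side is not yet `G r (Φ₀ 0 f)`, which has x in place of y.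
Φ₀-h· : ∀ N r .{{_ : NonZero (r + N)}} (f : QSym N) →
        Φ₀ (r + N) (h r · f) ≈ᴾ G r (y· (Ψ N (coeff f)))
Φ₀-h· N r f i j = trans (Φ₀-Ψ (r + N) (h r · f) i j)
  (trans (cong (λ k → coeffᴾ (y· (Ψ k (h[ r ]* coeff f))) i j) (ℕ.+-comm r N))
    (Ψ-h* N r (coeff f) (quasisymmetric f) (homogeneous f) i j))

Φ₀-h·≈G : ∀ N r (f : QSym N) → Φ₀ (r + N) (h r · f) ≈ᴾ G r (Φ₀ N f)
Φ₀-h·≈G (suc n) r f i j = trans
  (Φ₀-h· (suc n) r {{≢-nonZero (ℕ.m+1+n≢0 r)}} f i j)
  (sym (resp (G-linear r) {Φ₀ (suc n) f} {y· (Ψ (suc n) (coeff f))} (Φ₀-Ψ (suc n) f) i j))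
Φ₀-h·≈G zero r f i j with r ℕ.≟ 0
-- The total degree is 0, so `Φ₀-h·` does not apply; both sides are a constant times x.
... | yes refl = cong (ℚ._* coeffᴾ (x· 1ᴾ) i j) (h*-[] (coeff f))
... | no  r≢0  = begin
  coeffᴾ (Φ₀ (r + 0) (h r · f)) i j      ≡⟨ Φ₀-h· zero r {{≢-nonZero (r≢0 ∘ ℕ.m+n≡0⇒m≡0 r)}} f i j ⟩
  coeffᴾ (G r (y· (Ψ 0 (coeff f)))) i j  ≡⟨ G-yΨ₀ r {{≢-nonZero r≢0}} (coeff f) i j ⟩
  coeffᴾ (G r (x· (Ψ 0 (coeff f)))) i j  ≡⟨ resp (G-linear r) {Φ₀ 0 f} {x· (Ψ 0 (coeff f))} (Φ₀-zero f) i j ⟨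
  coeffᴾ (G r (Φ₀ 0 f)) i j              ∎
  where open ≡-Reasoning

-- Expansion in fundamental functions and uniqueness of Φ

-- Follows the recursion of `expand`, so that any linear Φ carries one to the other.
expandQ : ∀ {N n} → (Subset n → ℚ) → (Subset n → QSym N) → QSym N
expandQ {n = zero}  a φ = a [] *Q φ []
expandQ {n = suc n} a φ =
  expandQ (a ∘ (outside ∷_)) (φ ∘ (outside ∷_)) +Q
  expandQ (λ T → a (inside ∷ T) ℚ.- a (outside ∷ T)) (φ ∘ (inside ∷_))

expandQ-zero : ∀ {N n} (a : Subset n → ℚ) (φ : Subset n → QSym N) m →
               (∀ S → coeff (φ S) m ≡ 0ℚ) → coeff (expandQ a φ) m ≡ 0ℚ
expandQ-zero {n = zero}  a φ m φ≡0 = trans (cong (a [] ℚ.*_) (φ≡0 [])) (ℚ.*-zeroʳ (a []))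
expandQ-zero {n = suc n} a φ m φ≡0 = cong₂ ℚ._+_
  (expandQ-zero (a ∘ (outside ∷_)) (φ ∘ (outside ∷_)) m (φ≡0 ∘ (outside ∷_)))
  (expandQ-zero (λ T → a (inside ∷ T) ℚ.- a (outside ∷ T)) (φ ∘ (inside ∷_)) m (φ≡0 ∘ (inside ∷_)))

-- Möbius inversion on the lattice of subsets.
expandQ-χ : ∀ {N n} (a : Subset n → ℚ) (φ : Subset n → QSym N) m U →
            (∀ S → coeff (φ S) m ≡ χ S U) → coeff (expandQ a φ) m ≡ a U
expandQ-χ a φ m []            φ≡χ = trans (cong (a [] ℚ.*_) (φ≡χ [])) (ℚ.*-identityʳ (a []))
expandQ-χ a φ m (outside ∷ U) φ≡χ = trans
  (cong₂ ℚ._+_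
    (expandQ-χ (a ∘ (outside ∷_)) (φ ∘ (outside ∷_)) m U
      (λ S → trans (φ≡χ (outside ∷ S)) (χ-oo S U)))
    (expandQ-zero (λ T → a (inside ∷ T) ℚ.- a (outside ∷ T)) (φ ∘ (inside ∷_)) m
      (λ S → trans (φ≡χ (inside ∷ S)) (χ-io S U))))
  (ℚ.+-identityʳ (a (outside ∷ U)))
expandQ-χ a φ m (inside ∷ U)  φ≡χ = trans
  (cong₂ ℚ._+_
    (expandQ-χ (a ∘ (outside ∷_)) (φ ∘ (outside ∷_)) m U
      (λ S → trans (φ≡χ (outside ∷ S)) (χ-oi S U)))
    (expandQ-χ (λ T → a (inside ∷ T) ℚ.- a (outside ∷ T)) (φ ∘ (inside ∷_)) m U
      (λ S → trans (φ≡χ (inside ∷ S)) (χ-ii S U))))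
  (solve 2 (λ o i → o :+ (i :- o) := i) refl (a (outside ∷ U)) (a (inside ∷ U)))

F-mon : ∀ N (S T : Subset (N ∸ 1)) → coeff (F N S) (mon N T) ≡ χ S T
F-mon zero    [] [] = refl
F-mon (suc n) S  T  = F-comp n S T

-- T is read off from the left: a first part 1 gives `inside`, a larger one gives `outside` and is
-- lowered by 1.
positives-comp : ∀ n m → sumℕ m ≡ suc n → ∃ λ T → positives m ≡ comp {n} T
positives-comp n       (zero ∷ m)        eq = positives-comp n m eq
positives-comp zero    (suc zero ∷ m)    eq =
  [] , cong (1 ∷_) (positives-zero m (ℕ.suc-injective eq))
  where
  positives-zero : ∀ m → sumℕ m ≡ 0 → positives m ≡ []
  positives-zero []         _  = refl
  positives-zero (zero ∷ m) eq = positives-zero m eq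
positives-comp (suc n) (suc zero ∷ m)    eq with T , e ← positives-comp n m (ℕ.suc-injective eq) =
  inside ∷ T , cong (1 ∷_) e
positives-comp (suc n) (suc (suc e) ∷ m) eq
  with T , e ← positives-comp n (suc e ∷ m) (ℕ.suc-injective eq) = outside ∷ T , cong bump e

positives-mon : ∀ N m → sumℕ m ≡ N → ∃ λ T → positives m ≡ mon N T
positives-mon zero    []         eq = [] , refl
positives-mon zero    (zero ∷ m) eq = positives-mon zero m eq
positives-mon (suc n) m          eq = positives-comp n m eq

-- Homogeneity settles the monomials of other degrees; quasisymmetry deletes zero exponents from the
-- rest, which leaves a composition of N.
mon-determines : ∀ {N} (f g : QSym N) → (∀ T → coeff f (mon N T) ≡ coeff g (mon N T)) → f ≈Q g
mon-determines {N} f g f≡g m with sumℕ m ℕ.≟ N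
... | no  m≢N = trans (homogeneous f m m≢N) (sym (homogeneous g m m≢N))
... | yes m≡N with T , e ← positives-mon N m m≡N = begin
  coeff f m              ≡⟨ quasisymmetric f m (positives m) (sym (filter-idem (0 ℕ.<?_) m)) ⟩
  coeff f (positives m)  ≡⟨ cong (coeff f) e ⟩
  coeff f (mon N T)      ≡⟨ f≡g T ⟩
  coeff g (mon N T)      ≡⟨ cong (coeff g) e ⟨
  coeff g (positives m)  ≡⟨ quasisymmetric g m (positives m) (sym (filter-idem (0 ℕ.<?_) m)) ⟨
  coeff g m              ∎
  where open ≡-Reasoning

-- Shows that the fundamental functions span; by `mon-determines` it is enough to compare at
-- compositions, where Möbius inversion applies.
F-expansion : ∀ N (f : QSym N) → f ≈Q expandQ (coeff f ∘ mon N) (F N)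
F-expansion N f = mon-determines f (expandQ (coeff f ∘ mon N) (F N)) λ T →
  sym (expandQ-χ (coeff f ∘ mon N) (F N) (mon N T) T λ S → F-mon N S T)

module _ {Φ : ∀ N → QSym N → ℚ[x,y]} (isΦ : IsΦ Φ) where

  open LeftModuleMorphisms using (module IsLeftModuleHomomorphism)

  Φ-expandQ : ∀ N {n} (a : Subset n → ℚ) φ → Φ N (expandQ a φ) ≈ᴾ expand a (Φ N ∘ φ)
  Φ-expandQ N {zero}  a φ = *ₗ-homo (a []) (φ [])
    where open IsLeftModuleHomomorphism (IsΦ.linear isΦ N)
  Φ-expandQ N {suc n} a φ i j = trans
    (+ᴹ-homo (expandQ (a ∘ (outside ∷_)) (φ ∘ (outside ∷_))) (expandQ a′ (φ ∘ (inside ∷_))) i j)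
    (cong₂ ℚ._+_ (Φ-expandQ N (a ∘ (outside ∷_)) (φ ∘ (outside ∷_)) i j)
                 (Φ-expandQ N a′ (φ ∘ (inside ∷_)) i j))
    where
    open IsLeftModuleHomomorphism (IsΦ.linear isΦ N)
    a′ = λ T → a (inside ∷ T) ℚ.- a (outside ∷ T)

  -- A linear map is fixed by its values on a spanning family, which reduces the theorem to the
  -- explicit `Φ₀`.
  Φ-unique : ∀ N f → Φ N f ≈ᴾ Φ₀ N f
  Φ-unique N f i j = trans (⟦⟧-cong {f} {expandQ (coeff f ∘ mon N) (F N)} (F-expansion N f) i j)
    (trans (Φ-expandQ N (coeff f ∘ mon N) (F N) i j)
      (expand-resp (coeff f ∘ mon N) (IsΦ.Φ-F isΦ N) i j))
    where open IsLeftModuleHomomorphism (IsΦ.linear isΦ N)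

theorem11 : (Φ : ∀ N → QSym N → ℚ[x,y]) → IsΦ Φ →
    (N r : ℕ) (f : QSym N) →
    Φ (r + N) (h r · f) ≈ᴾ 𝒢 r (Φ N f)
theorem11 Φ isΦ N r f i j = begin
  coeffᴾ (Φ (r + N) (h r · f)) i j    ≡⟨ Φ-unique isΦ (r + N) (h r · f) i j ⟩
  coeffᴾ (Φ₀ (r + N) (h r · f)) i j   ≡⟨ Φ₀-h·≈G N r f i j ⟩
  coeffᴾ (G r (Φ₀ N f)) i j           ≡⟨ resp (G-linear r) (Φ-unique isΦ N f) i j ⟨
  coeffᴾ (G r (Φ N f)) i j            ≡⟨ 𝒢≈G r (Φ N f) i j ⟨
  coeffᴾ (𝒢 r (Φ N f)) i j            ∎
  where open ≡-Reasoning
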